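{- Let $G$ and $H$ be finite simple graphs, each of order at least $2$, such that the Cartesian product $G \,\Box\, H$ is connected. Then $G \,\Box\, H$ is well-dominated if and only if $G \,\Box\, H$ is isomorphic to $P_3 \,\Box\, K_3$ or $G \,\Box\, H$ is isomorphic to $K_n \,\Box\, K_n$ for some $n \ge 2$.
   Context: All graphs are finite and simple (undirected, no loops, no multiple edges). The order of a graph is its number of vertices. For a graph $X$ and $S \subseteq V(X)$, the closed neighborhood $N[S]$ is $S$ together with all vertices adjacent to some vertex of $S$. A dominating set of $X$ is a set $S \subseteq V(X)$ with $N[S] = V(X)$; it is minimal if $S - \{x\}$ does not dominate $X$ for every $x \in S$. The domination number $\gamma(X)$ is the cardinality of a smallest dominating set of $X$. The graph $X$ is well-dominated if all of its minimal dominating sets have the same cardinality, namely $\gamma(X)$. The Cartesian product $X \,\Box\, Y$ has vertex set $V(X) \times V(Y)$, and two vertices $(x_1,y_1)$ and $(x_2,y_2)$ are adjacent if they are equal in one coordinate and adjacent in the other coordinate. $P_3$ is the path on three vertices and $K_n$ is the complete graph on $n$ vertices. -}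

module Defs where

open import Data.Fin.Base using (Fin; toℕ)
import Data.Fin.Properties as Fin
open import Data.Fin.Subset using (Subset; ∣_∣) renaming (_∈_ to _∈ᶠ_; _-_ to _-ᶠ_)
open import Data.Nat.Base using (ℕ; suc; _*_; _≤_)
import Data.Nat.Properties as ℕ
open import Data.Product.Base using (_×_; _,_; ∃-syntax)
open import Data.Product.Function.NonDependent.Propositional using (_×-↔_)
open import Data.Sum.Base using (_⊎_; inj₁; inj₂; map; swap)
open import Function.Base using (_∘_)
open import Function.Bundles using (_↔_; _⇔_; Inverse)
open import Function.Construct.Identity using (↔-id)
open import Function.Construct.Composition using (_↔-∘_)
open import Function.Construct.Symmetry using (↔-sym)
open import Function.Properties.Inverse using (↔⇒↣)
open import Level using (0ℓ)
open import Relation.Binary.Construct.Closure.ReflexiveTransitive using (Star)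
open import Relation.Binary.Core using (Rel)
open import Relation.Binary.Definitions
  using (Decidable; DecidableEquality; Irreflexive; Symmetric)
open import Relation.Binary.PropositionalEquality using (_≡_; _≢_; refl; sym)
open import Relation.Nullary.Decidable using (_×-dec_; _⊎-dec_; ¬?; via-injection)
open import Relation.Nullary.Negation using (¬_)
open import Relation.Unary using (Pred)

-- Adjacency is decidable because a classical finite graph is given by a
-- {0,1}-valued adjacency matrix.  Proofs of adjacency need not be unique, so
-- only the truth of `Adj u v` may matter below (there are no multiple edges).

record Graph : Set₁ where
  field
    Vertex     : Set
    order      : ℕ
    enum       : Vertex ↔ Fin order
    Adj        : Rel Vertex 0ℓ
    adj?       : Decidable Adj
    adj-irrefl : Irreflexive _≡_ Adj
    adj-sym    : Symmetric Adj

  index : Vertex → Fin order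
  index = Inverse.to enum

  _≟ᵛ_ : DecidableEquality Vertex
  _≟ᵛ_ = via-injection (↔⇒↣ enum) Fin._≟_

open Graph

-- Sets of vertices are represented by the corresponding sets of indices
-- under `enum`, so that the cardinality of S is the library's ∣ S ∣.

VertexSet : Graph → Set
VertexSet X = Subset (order X)

module _ (X : Graph) where

  infix 4 _∈ᵛ_

  _∈ᵛ_ : Vertex X → VertexSet X → Set
  v ∈ᵛ S = index X v ∈ᶠ S

  remove : VertexSet X → Vertex X → VertexSet X
  remove S v = S -ᶠ index X v

  N[_] : VertexSet X → Pred (Vertex X) 0ℓ
  N[ S ] v = v ∈ᵛ S ⊎ (∃[ u ] (u ∈ᵛ S × Adj X u v))

  Dominating : VertexSet X → Set
  Dominating S = ∀ v → N[ S ] v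

  MinimalDominating : VertexSet X → Set
  MinimalDominating S = Dominating S × (∀ x → x ∈ᵛ S → ¬ Dominating (remove S x))

  -- "γ(X) = k".

  IsDominationNumber : ℕ → Set
  IsDominationNumber k =
      (∃[ S ] (Dominating S × ∣ S ∣ ≡ k))
    × (∀ S → Dominating S → k ≤ ∣ S ∣)

  WellDominated : Set
  WellDominated =
    ∃[ γ ] (IsDominationNumber γ × (∀ S → MinimalDominating S → ∣ S ∣ ≡ γ))

  Connected : Set
  Connected = ∀ u v → Star (Adj X) u v

infix 4 _≅_

record _≅_ (X Y : Graph) : Set where
  field
    vertex-bij : Vertex X ↔ Vertex Y
    adj-iff    : ∀ u v →
      Adj X u v ⇔ Adj Y (Inverse.to vertex-bij u) (Inverse.to vertex-bij v)

infixr 7 _□_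

_□_ : Graph → Graph → Graph
X □ Y = record
  { Vertex     = Vertex X × Vertex Y
  ; order      = order X * order Y
  ; enum       = ↔-sym Fin.*↔× ↔-∘ (enum X ×-↔ enum Y)
  ; Adj        = λ (x₁ , y₁) (x₂ , y₂) →
                   (x₁ ≡ x₂ × Adj Y y₁ y₂) ⊎ (Adj X x₁ x₂ × y₁ ≡ y₂)
  ; adj?       = λ (x₁ , y₁) (x₂ , y₂) →
                   (_≟ᵛ_ X x₁ x₂ ×-dec adj? Y y₁ y₂)
                   ⊎-dec (adj? X x₁ x₂ ×-dec _≟ᵛ_ Y y₁ y₂)
  ; adj-irrefl = λ { refl (inj₁ (_ , a)) → adj-irrefl Y refl a
                   ; refl (inj₂ (a , _)) → adj-irrefl X refl a }
  ; adj-sym    = map (λ (e , a) → sym e , adj-sym Y a)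
                     (λ (a , e) → adj-sym X a , sym e)
  }

K : ℕ → Graph
K n = record
  { Vertex     = Fin n
  ; order      = n
  ; enum       = ↔-id (Fin n)
  ; Adj        = _≢_
  ; adj?       = λ i j → ¬? (i Fin.≟ j)
  ; adj-irrefl = λ i≡j i≢j → i≢j i≡j
  ; adj-sym    = λ i≢j → i≢j ∘ sym
  }

P : ℕ → Graph
P n = record
  { Vertex     = Fin n
  ; order      = n
  ; enum       = ↔-id (Fin n)
  ; Adj        = λ i j → suc (toℕ i) ≡ toℕ j ⊎ suc (toℕ j) ≡ toℕ i
  ; adj?       = λ i j → (suc (toℕ i) ℕ.≟ toℕ j) ⊎-dec (suc (toℕ j) ℕ.≟ toℕ i)
  ; adj-irrefl = λ { refl (inj₁ e) → ℕ.1+n≢n e ; refl (inj₂ e) → ℕ.1+n≢n e }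
  ; adj-sym    = swap
  }

{-# OPTIONS --safe #-}
module Submission where

-- By Bollobás and Cockayne, a graph without isolated vertices has a dominating
-- set D in which every vertex has a private neighbour outside D; let E be such a
-- set in H.  Then D × H and G × E are minimal dominating sets of G □ H, so both
-- have size γ.  Assign every v ∈ G to a dominator r v ∈ D, and similarly for H.
-- Trading {d} × W_e for V_d × {e} inside D × H shows |W_e| ≤ |V_d|; by symmetry
-- all classes V_d, W_e have the same size k.  As this holds for every assignment,
-- D is a perfect code.
--
-- Minimal dominating sets obtained from D × H by local changes then have to have
-- size γ too, which forces every V_d to be a clique or a path P₃ with centre d,
-- and forbids edges between different classes.  By connectedness |D| = |E| = 1,
-- so that each factor is complete or P₃, both of order k; in P₃ □ P₃ the corners
-- and the centre form a minimal dominating set that is too large.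

open import Defs
open import Algebra.Properties.Semiring.Sum using ()
open import Data.Bool.Base using (T; true; false; if_then_else_)
open import Data.Empty using (⊥; ⊥-elim)
open import Data.Fin.Base using (Fin; zero; suc; _↑ˡ_; _↑ʳ_; combine; remQuot; fromℕ<)
open import Data.Fin.Patterns using (0F; 1F; 2F)
open import Data.Fin.Permutation using (↔⇒≡)
import Data.Fin.Properties as Fin
open import Data.Fin.Subset using (Subset; ∣_∣; ⁅_⁆; inside; outside)
  renaming (_∈_ to _∈ᶠ_; _-_ to _-ᶠ_)
import Data.Fin.Subset.Properties as Subset
open import Data.List.Base using (List; []; _∷_)
open import Data.Nat.Base using (ℕ; zero; suc; _+_; _*_; _≤_; _<_; _≤ᵇ_; z≤n; s≤s)
open import Data.Nat.Induction using (<-wellFounded)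
import Data.Nat.Properties as ℕ
open import Data.Nat.Tactic.RingSolver using (solve-∀)
open import Data.Product.Base using (_×_; _,_; ∃-syntax; proj₁; proj₂; uncurry)
open import Data.Product.Function.NonDependent.Propositional using (_×-↔_)
open import Data.Sum.Base using (_⊎_; inj₁; inj₂; [_,_]′; map)
open import Data.Unit.Base using (⊤; tt)
open import Data.Vec.Base using ([]; _∷_; lookup; tabulate; here; there)
open import Data.Vec.Properties using (lookup∘tabulate; []=⇒lookup; lookup⇒[]=)
open import Function.Base using (_∘_; id)
open import Function.Bundles using (_⇔_; _↔_; Inverse; mk⇔; mk↔ₛ′; Equivalence)
open import Function.Construct.Composition using (_↔-∘_; _⇔-∘_)
open import Function.Construct.Symmetry using (↔-sym)
open import Induction.WellFounded using (Acc; acc)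
open import Relation.Binary.Construct.Closure.ReflexiveTransitive using (Star; ε; _◅_)
open import Relation.Binary.Definitions using (DecidableEquality)
open import Relation.Binary.PropositionalEquality
  using (_≡_; _≢_; refl; sym; trans; cong; cong₂; subst; subst₂; module ≡-Reasoning)
open import Relation.Nullary.Decidable
  using ( Dec; yes; no; does; map′; _×-dec_; _⊎-dec_; _→-dec_; ¬?; decidable-stable
        ; dec-true; dec-false; from-yes; toSum; toWitnessFalse)
open import Relation.Nullary.Negation using (¬_; contradiction)
open import Relation.Unary using (Decidable)
open Algebra.Properties.Semiring.Sum ℕ.+-*-semiring
  using (sum; ∑-distrib-+; ∑-comm; sum-permute; *-distribˡ-sum; *-distribʳ-sum)
  renaming (sum-cong-≗ to sum-cong)

open Graph using (Vertex; order; enum; index)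

-- Sums over vertices

-- Well-domination enters the forward direction in two ways only: no dominating set has fewer than γ
-- vertices, and a dominating set in which every vertex has a private neighbour has exactly γ. All
-- local changes start from D × H, whose size |D||H| is γ, so that only gains and losses have to be
-- compared.
--
-- The obstacle is that nothing is known about H while G is analysed. The modified sets therefore
-- refer in H only to one class W_e, to one vertex w₀, or to E with its external private neighbours.
-- The recurring surplus |E| has this origin: some column {v} × H is left to be dominated from
-- within, and {v} × E does that without redundancy.
--
-- Vertices of D away from a change keep a private neighbour because every class contains a vertex,
-- other than its centre, whose closed neighbourhood stays inside the class. The equality of all
-- class sizes is what yields it: the set that refutes its absence has γ - 1 vertices precisely
-- because |V_d| = |W_e| = k and |G| = |D|k.

⟦_⟧ : ∀ {a} {P : Set a} → Dec P → ℕ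
⟦ P? ⟧ = if does P? then 1 else 0

module _ {a} {P : Set a} where

  ⟦⟧-true : (P? : Dec P) → P → ⟦ P? ⟧ ≡ 1
  ⟦⟧-true (yes _) _ = refl
  ⟦⟧-true (no ¬p) p = contradiction p ¬p

  ⟦⟧-false : (P? : Dec P) → ¬ P → ⟦ P? ⟧ ≡ 0
  ⟦⟧-false (yes p) ¬p = contradiction p ¬p
  ⟦⟧-false (no _)  _  = refl

  ⟦⟧≤1 : (P? : Dec P) → ⟦ P? ⟧ ≤ 1
  ⟦⟧≤1 (yes _) = ℕ.≤-refl
  ⟦⟧≤1 (no _)  = z≤n

⟦⟧-mono : ∀ {a b} {P : Set a} {Q : Set b} (P? : Dec P) (Q? : Dec Q) → (P → Q) → ⟦ P? ⟧ ≤ ⟦ Q? ⟧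
⟦⟧-mono (yes p) Q? P→Q = ℕ.≤-reflexive (sym (⟦⟧-true Q? (P→Q p)))
⟦⟧-mono (no _)  Q? P→Q = z≤n

⟦⟧-cong : ∀ {a b} {P : Set a} {Q : Set b} (P? : Dec P) (Q? : Dec Q) → P ⇔ Q → ⟦ P? ⟧ ≡ ⟦ Q? ⟧
⟦⟧-cong P? (yes q) P⇔Q = ⟦⟧-true P? (Equivalence.from P⇔Q q)
⟦⟧-cong P? (no ¬q) P⇔Q = ⟦⟧-false P? (¬q ∘ Equivalence.to P⇔Q)

sum-mono : ∀ {n} {f g : Fin n → ℕ} → (∀ i → f i ≤ g i) → sum f ≤ sum g
sum-mono {zero}  f≤g = z≤n
sum-mono {suc n} f≤g = ℕ.+-mono-≤ (f≤g zero) (sum-mono (f≤g ∘ suc))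

term≤sum : ∀ {n} (f : Fin n → ℕ) i → f i ≤ sum f
term≤sum f zero    = ℕ.m≤m+n _ _
term≤sum f (suc i) = ℕ.≤-trans (term≤sum (f ∘ suc) i) (ℕ.m≤n+m _ _)

sum-1 : ∀ n → sum {n} (λ _ → 1) ≡ n
sum-1 zero    = refl
sum-1 (suc n) = cong suc (sum-1 n)

sum-0 : ∀ n → sum {n} (λ _ → 0) ≡ 0
sum-0 zero    = refl
sum-0 (suc n) = sum-0 n

sum-point : ∀ {n} (f : Fin n → ℕ) i → f i ≡ 1 → (∀ j → j ≢ i → f j ≡ 0) → sum f ≡ 1
sum-point {suc n} f zero fi≡1 f≡0 =
  cong₂ _+_ fi≡1 (trans (sum-cong (λ j → f≡0 (suc j) λ ())) (sum-0 n))
sum-point f (suc i) fi≡1 f≡0 =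
  cong₂ _+_ (f≡0 zero λ ())
    (sum-point (f ∘ suc) i fi≡1 λ j j≢i → f≡0 (suc j) (j≢i ∘ Fin.suc-injective))

sum-++ : ∀ m n (f : Fin (m + n) → ℕ) → sum f ≡ sum (λ i → f (i ↑ˡ n)) + sum (λ j → f (m ↑ʳ j))
sum-++ zero    n f = refl
sum-++ (suc m) n f =
  trans (cong (f zero +_) (sum-++ m n (f ∘ suc))) (sym (ℕ.+-assoc (f zero) _ _))

sum-combine : ∀ m n (f : Fin (m * n) → ℕ) → sum f ≡ sum λ i → sum λ j → f (combine {m} {n} i j)
sum-combine zero    n f = refl
sum-combine (suc m) n f =
  trans (sum-++ n (m * n) f)
    (cong (sum (λ i → f (i ↑ˡ (m * n))) +_) (sum-combine m n (f ∘ (n ↑ʳ_))))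

card-subset : ∀ {n} (S : Subset n) → ∣ S ∣ ≡ sum (λ i → ⟦ i Subset.∈? S ⟧)
card-subset []            = refl
card-subset (inside ∷ S)  = cong suc (card-subset S)
card-subset (outside ∷ S) = card-subset S

x∉p-x : ∀ {n} (S : Subset n) i → ¬ (i ∈ᶠ S -ᶠ i)
x∉p-x (_ ∷ S) zero    ()
x∉p-x (_ ∷ S) (suc i) (there i∈) = x∉p-x S i i∈

-- Opaque, so that `with` can abstract over it: the comparison of indices behind
-- it must not unfold.
opaque
  eq? : ∀ X → DecidableEquality (Vertex X)
  eq? X = Graph._≟ᵛ_ X

module _ (X : Graph) where

  vertexAt : Fin (order X) → Vertex X
  vertexAt = Inverse.from (enum X)

  index-vertexAt : ∀ i → index X (vertexAt i) ≡ i
  index-vertexAt i = Inverse.inverseˡ (enum X) refl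

  vertexAt-index : ∀ v → vertexAt (index X v) ≡ v
  vertexAt-index v = Inverse.inverseʳ (enum X) refl

  index-injective : ∀ {u v} → index X u ≡ index X v → u ≡ v
  index-injective {u} {v} e = trans (sym (vertexAt-index u)) (trans (cong vertexAt e) (vertexAt-index v))

  -- Opaque, so that unification can read f off ∑ f.
  opaque

    ∑ : (Vertex X → ℕ) → ℕ
    ∑ f = sum (f ∘ vertexAt)

    ∑-cong : {f g : Vertex X → ℕ} → (∀ v → f v ≡ g v) → ∑ f ≡ ∑ g
    ∑-cong f≡g = sum-cong (f≡g ∘ vertexAt)

    ∑-mono : {f g : Vertex X → ℕ} → (∀ v → f v ≤ g v) → ∑ f ≤ ∑ g
    ∑-mono f≤g = sum-mono (f≤g ∘ vertexAt)

    ∑-+ : (f g : Vertex X → ℕ) → ∑ (λ v → f v + g v) ≡ ∑ f + ∑ g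
    ∑-+ f g = ∑-distrib-+ (f ∘ vertexAt) (g ∘ vertexAt)

    ∑-*ˡ : ∀ c (f : Vertex X → ℕ) → ∑ (λ v → c * f v) ≡ c * ∑ f
    ∑-*ˡ c f = sym (*-distribˡ-sum c (f ∘ vertexAt))

    ∑-*ʳ : ∀ c (f : Vertex X → ℕ) → ∑ (λ v → f v * c) ≡ ∑ f * c
    ∑-*ʳ c f = sym (*-distribʳ-sum c (f ∘ vertexAt))

    ∑-1 : ∑ (λ _ → 1) ≡ order X
    ∑-1 = sum-1 (order X)

    term≤∑ : ∀ f v → f v ≤ ∑ f
    term≤∑ f v = subst (λ u → f u ≤ ∑ f) (vertexAt-index v) (term≤sum (f ∘ vertexAt) (index X v))

    ∑-point : (f : Vertex X → ℕ) → ∀ v → f v ≡ 1 → (∀ u → u ≢ v → f u ≡ 0) → ∑ f ≡ 1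
    ∑-point f v fv≡1 f≡0 =
      sum-point (f ∘ vertexAt) (index X v) (trans (cong f (vertexAt-index v)) fv≡1)
        λ j j≢i → f≡0 (vertexAt j) λ { refl → j≢i (sym (index-vertexAt j)) }

  δ : Vertex X → Vertex X → ℕ
  δ u v = ⟦ eq? X v u ⟧

  ∑-δ : ∀ u → ∑ (δ u) ≡ 1
  ∑-δ u = ∑-point (δ u) u (⟦⟧-true (eq? X u u) refl) λ v → ⟦⟧-false (eq? X v u)

  ∑-strict : {f g : Vertex X → ℕ} → (∀ v → f v ≤ g v) → ∀ v → f v < g v → ∑ f < ∑ g
  ∑-strict {f} {g} f≤g v fv<gv = begin
    suc (∑ f)                   ≡⟨ ℕ.+-comm 1 (∑ f) ⟩
    ∑ f + 1                     ≡⟨ cong (∑ f +_) (sym (∑-δ v)) ⟩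
    ∑ f + ∑ (δ v)               ≡⟨ sym (∑-+ f (δ v)) ⟩
    ∑ (λ u → f u + δ v u)       ≤⟨ ∑-mono pointwise ⟩
    ∑ g                         ∎
    where
    open ℕ.≤-Reasoning
    pointwise : ∀ u → f u + δ v u ≤ g u
    pointwise u with eq? X u v
    ... | yes refl = subst (_≤ g u) (ℕ.+-comm 1 (f u)) fv<gv
    ... | no _     = subst (_≤ g u) (sym (ℕ.+-identityʳ (f u))) (f≤g u)

  any? : {P : Vertex X → Set} → Decidable P → Dec (∃[ v ] P v)
  any? {P} P? = map′
    (λ (i , p) → vertexAt i , p)
    (λ (v , p) → index X v , subst P (sym (vertexAt-index v)) p)
    (Fin.any? (P? ∘ vertexAt))

  all? : {P : Vertex X → Set} → Decidable P → (∀ v → P v) ⊎ ∃[ v ] ¬ P v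
  all? P? with any? (¬? ∘ P?)
  ... | yes v¬p = inj₂ v¬p
  ... | no ∄¬p = inj₁ λ v → decidable-stable (P? v) λ ¬p → ∄¬p (v , ¬p)

opaque
  unfolding ∑

  ∑-reindex : ∀ X Y (π : Vertex X ↔ Vertex Y) (f : Vertex Y → ℕ) → ∑ Y f ≡ ∑ X (f ∘ Inverse.to π)
  ∑-reindex X Y π f = begin
    ∑ Y f                                                ≡⟨ sum-permute (f ∘ vertexAt Y) ρ ⟩
    sum (f ∘ vertexAt Y ∘ Inverse.to ρ)
      ≡⟨ sum-cong (λ i → cong f (vertexAt-index Y (Inverse.to π (vertexAt X i)))) ⟩
    ∑ X (f ∘ Inverse.to π)                               ∎
    where
    open ≡-Reasoning
    ρ : Fin (order X) ↔ Fin (order Y)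
    ρ = enum Y ↔-∘ (π ↔-∘ ↔-sym (enum X))

  ∑-swap : ∀ X Y (f : Vertex X → Vertex Y → ℕ) →
            (∑ X λ v → ∑ Y λ w → f v w) ≡ (∑ Y λ w → ∑ X λ v → f v w)
  ∑-swap X Y f = ∑-comm λ i j → f (vertexAt X i) (vertexAt Y j)

  ∑-□ : ∀ X Y (f : Vertex (X □ Y) → ℕ) → ∑ (X □ Y) f ≡ (∑ X λ v → ∑ Y λ w → f (v , w))
  ∑-□ X Y f = begin
    ∑ (X □ Y) f
      ≡⟨ sum-combine (order X) (order Y) (f ∘ vertexAt (X □ Y)) ⟩
    (sum λ i → sum λ j → g (remQuot {order X} (order Y) (combine {order X} {order Y} i j)))
      ≡⟨ sum-cong (λ i → sum-cong λ j → cong g (Fin.remQuot-combine {order X} i j)) ⟩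
    (∑ X λ v → ∑ Y λ w → f (v , w)) ∎
    where
    open ≡-Reasoning
    g : Fin (order X) × Fin (order Y) → ℕ
    g (i , j) = f (vertexAt X i , vertexAt Y j)

-- Well-domination

-- Vertex sets as decidable predicates: they do not refer to the enumeration of the
-- vertices, and so adapt to products and isomorphisms without reindexing.
record Sub (A : Set) : Set₁ where
  constructor _given_
  field
    Mem  : A → Set
    mem? : Decidable Mem

open Sub

infix 4 _∈_

_∈_ : ∀ {A} → A → Sub A → Set
a ∈ S = Mem S a

infix 4 _⊑_

_⊑_ : ∀ {A} → Sub A → Sub A → Set
S ⊑ T = ∀ {a} → a ∈ S → a ∈ T

module _ (X : Graph) where

  open Graph X using (Adj; adj?; adj-sym)

  card : Sub (Vertex X) → ℕ
  card S = ∑ X λ v → ⟦ mem? S v ⟧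

  N : Vertex X → Vertex X → Set
  N u v = u ≡ v ⊎ Adj u v

  N? : ∀ u v → Dec (N u v)
  N? u v = eq? X u v ⊎-dec adj? u v

  N-sym : ∀ {u v} → N u v → N v u
  N-sym = map sym adj-sym

  Covers : Sub (Vertex X) → Set
  Covers S = ∀ v → ∃[ u ] (u ∈ S × N u v)

  -- Comparing with all covering subsets is equivalent to deleting single vertices, since a covering
  -- subset that misses u lies inside S - u. In this form nothing is ever deleted, which suits
  -- private neighbours and transport along isomorphisms.
  Minimal : Sub (Vertex X) → Set₁
  Minimal S = ∀ T → Covers T → T ⊑ S → S ⊑ T

  Irredundant : Sub (Vertex X) → Set
  Irredundant S = ∀ u → u ∈ S → ∃[ p ] (N u p × (∀ u′ → u′ ∈ S → N u′ p → u′ ≡ u))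

  irredundant⇒minimal : ∀ {S} → Irredundant S → Minimal S
  irredundant⇒minimal irr T cov T⊑S {u} u∈S with irr u u∈S
  ... | p , _ , private-p with cov p
  ...   | u′ , u′∈T , Nu′p = subst (_∈ T) (private-p u′ (T⊑S u′∈T) Nu′p) u′∈T

record WD (X : Graph) : Set₁ where
  field
    γ         : ℕ
    attained  : ∃[ S ] (Covers X S × card X S ≡ γ)
    bound     : ∀ S → Covers X S → γ ≤ card X S
    minimal≡γ : ∀ S → Covers X S → Minimal X S → card X S ≡ γ

card-mono : ∀ X {S T} → S ⊑ T → card X S ≤ card X T
card-mono X {S} {T} S⊑T = ∑-mono X λ v → ⟦⟧-mono (mem? S v) (mem? T v) S⊑T

card-strict : ∀ X {S T} → S ⊑ T → ∀ {v} → ¬ v ∈ S → v ∈ T → card X S < card X T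
card-strict X {S} {T} S⊑T {v} v∉S v∈T =
  ∑-strict X (λ u → ⟦⟧-mono (mem? S u) (mem? T u) S⊑T) v
    (subst₂ _<_ (sym (⟦⟧-false (mem? S v) v∉S)) (sym (⟦⟧-true (mem? T v) v∈T)) (s≤s z≤n))

card-⊑⊒ : ∀ X {S T} → S ⊑ T → T ⊑ S → card X S ≡ card X T
card-⊑⊒ X {S} {T} S⊑T T⊑S = ∑-cong X λ v → ⟦⟧-cong (mem? S v) (mem? T v) (mk⇔ S⊑T T⊑S)

two≤card : ∀ X {S x y} → x ∈ S → y ∈ S → x ≢ y → 2 ≤ card X S
two≤card X {S} {x} {y} x∈S y∈S x≢y = subst (_≤ card X S)
  (trans (∑-+ X (δ X x) (δ X y)) (cong₂ _+_ (∑-δ X x) (∑-δ X y)))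
  (∑-mono X pointwise)
  where
  pointwise : ∀ v → δ X x v + δ X y v ≤ ⟦ mem? S v ⟧
  pointwise v with eq? X v x | eq? X v y | mem? S v
  ... | yes refl | yes refl | _      = contradiction refl x≢y
  ... | yes refl | no _     | yes _  = ℕ.≤-refl
  ... | yes refl | no _     | no x∉S = contradiction x∈S x∉S
  ... | no _     | yes refl | yes _  = ℕ.≤-refl
  ... | no _     | yes refl | no y∉S = contradiction y∈S y∉S
  ... | no _     | no _     | _      = z≤n

-- Index sets and predicates

module _ (X : Graph) where

  fromSubset : VertexSet X → Sub (Vertex X)
  fromSubset S = (λ v → index X v ∈ᶠ S) given λ v → index X v Subset.∈? S

  toSubset : Sub (Vertex X) → VertexSet X
  toSubset S = tabulate λ i → does (mem? S (vertexAt X i))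

  ∈-toSubset⁺ : ∀ {v} S → v ∈ S → index X v ∈ᶠ toSubset S
  ∈-toSubset⁺ {v} S v∈S = lookup⇒[]= (index X v) (toSubset S) (begin
    lookup (toSubset S) (index X v)           ≡⟨ lookup∘tabulate _ (index X v) ⟩
    does (mem? S (vertexAt X (index X v)))    ≡⟨ cong (does ∘ mem? S) (vertexAt-index X v) ⟩
    does (mem? S v)                           ≡⟨ dec-true (mem? S v) v∈S ⟩
    true                                      ∎)
    where open ≡-Reasoning

  ∈-toSubset⁻ : ∀ {v} S → index X v ∈ᶠ toSubset S → v ∈ S
  ∈-toSubset⁻ {v} S v∈S = decidable-stable (mem? S v) λ v∉S → contradiction (begin
    true                                      ≡⟨ sym ([]=⇒lookup v∈S) ⟩
    lookup (toSubset S) (index X v)           ≡⟨ lookup∘tabulate _ (index X v) ⟩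
    does (mem? S (vertexAt X (index X v)))    ≡⟨ cong (does ∘ mem? S) (vertexAt-index X v) ⟩
    does (mem? S v)                           ≡⟨ dec-false (mem? S v) v∉S ⟩
    false                                     ∎) λ ()
    where open ≡-Reasoning

  opaque
    unfolding ∑

    card-fromSubset : ∀ S → card X (fromSubset S) ≡ ∣ S ∣
    card-fromSubset S = trans
      (sum-cong λ i → cong (λ j → ⟦ j Subset.∈? S ⟧) (index-vertexAt X i))
      (sym (card-subset S))

  card-toSubset : ∀ S → ∣ toSubset S ∣ ≡ card X S
  card-toSubset S = trans (sym (card-fromSubset (toSubset S)))
    (card-⊑⊒ X {fromSubset (toSubset S)} {S} (∈-toSubset⁻ S) (∈-toSubset⁺ S))

  dominating⇒covers : ∀ S T → (∀ {v} → index X v ∈ᶠ S → v ∈ T) → Dominating X S → Covers X T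
  dominating⇒covers S T S⊆T dom v with dom v
  ... | inj₁ v∈S           = v , S⊆T v∈S , inj₁ refl
  ... | inj₂ (u , u∈S , a) = u , S⊆T u∈S , inj₂ a

  covers⇒dominating : ∀ S T → (∀ {v} → v ∈ T → index X v ∈ᶠ S) → Covers X T → Dominating X S
  covers⇒dominating S T T⊆S cov v with cov v
  ... | u , u∈T , inj₁ refl = inj₁ (T⊆S u∈T)
  ... | u , u∈T , inj₂ a    = inj₂ (u , T⊆S u∈T , a)

  minimal⇒minimalDominating : ∀ S → Covers X S → Minimal X S → MinimalDominating X (toSubset S)
  minimal⇒minimalDominating S cov min =
      covers⇒dominating (toSubset S) S (∈-toSubset⁺ S) cov
    , λ x x∈S dom → let R = remove X (toSubset S) x in
        x∉p-x (toSubset S) (index X x)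
          (min (fromSubset R) (dominating⇒covers R (fromSubset R) (λ v∈ → v∈) dom)
            (λ v∈R → ∈-toSubset⁻ S (Subset.p─q⊆p (toSubset S) ⁅ index X x ⁆ v∈R))
            (∈-toSubset⁻ S x∈S))

  minimalDominating⇒minimal : ∀ S → MinimalDominating X S → Minimal X (fromSubset S)
  minimalDominating⇒minimal S (_ , min) T cov T⊑S {u} u∈S =
    decidable-stable (mem? T u) λ u∉T → min u u∈S
      (covers⇒dominating (remove X S u) T
        (λ {v} v∈T → Subset.x∈p∧x≢y⇒x∈p-y (T⊑S v∈T)
          λ e → u∉T (subst (_∈ T) (index-injective X e) v∈T))
        cov)

  wellDominated⇒WD : WellDominated X → WD X
  wellDominated⇒WD (γ , ((S₀ , dom₀ , ∣S₀∣≡γ) , bound) , minimal) = record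
    { γ = γ
    ; attained = fromSubset S₀ , dominating⇒covers S₀ (fromSubset S₀) (λ v∈ → v∈) dom₀
               , trans (card-fromSubset S₀) ∣S₀∣≡γ
    ; bound = λ S cov → subst (γ ≤_) (card-toSubset S)
        (bound (toSubset S) (covers⇒dominating (toSubset S) S (∈-toSubset⁺ S) cov))
    ; minimal≡γ = λ S cov min → trans (sym (card-toSubset S))
        (minimal (toSubset S) (minimal⇒minimalDominating S cov min))
    }

  WD⇒wellDominated : WD X → WellDominated X
  WD⇒wellDominated wd =
      γ
    , ( ( toSubset S₀ , covers⇒dominating (toSubset S₀) S₀ (∈-toSubset⁺ S₀) cov₀
        , trans (card-toSubset S₀) card≡γ)
      , λ S dom → subst (γ ≤_) (card-fromSubset S)
          (bound (fromSubset S) (dominating⇒covers S (fromSubset S) (λ v∈ → v∈) dom)))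
    , λ S min → trans (sym (card-fromSubset S))
        (minimal≡γ (fromSubset S) (dominating⇒covers S (fromSubset S) (λ v∈ → v∈) (proj₁ min))
          (minimalDominating⇒minimal S min))
    where
    open WD wd
    S₀ = proj₁ attained
    cov₀ = proj₁ (proj₂ attained)
    card≡γ = proj₂ (proj₂ attained)

-- Invariance under isomorphism

≅-sym : ∀ {X Y} → X ≅ Y → Y ≅ X
≅-sym {X} {Y} X≅Y = record
  { vertex-bij = ↔-sym vertex-bij
  ; adj-iff    = λ u v → mk⇔
      (λ a → Equivalence.from (adj-iff (from u) (from v))
        (subst₂ (Graph.Adj Y) (sym (to-from u)) (sym (to-from v)) a))
      (λ a → subst₂ (Graph.Adj Y) (to-from u) (to-from v)
        (Equivalence.to (adj-iff (from u) (from v)) a))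
  }
  where
  open _≅_ X≅Y
  open Inverse vertex-bij using (to; from)
  to-from : ∀ v → to (from v) ≡ v
  to-from v = Inverse.inverseˡ vertex-bij refl

module _ {X Y : Graph} (X≅Y : X ≅ Y) where

  open _≅_ X≅Y
  open Inverse vertex-bij using (to; from)

  pullback : Sub (Vertex Y) → Sub (Vertex X)
  pullback S = (λ v → to v ∈ S) given (λ v → mem? S (to v))

  card-pullback : ∀ S → card X (pullback S) ≡ card Y S
  card-pullback S = sym (∑-reindex X Y vertex-bij λ v → ⟦ mem? S v ⟧)

  pullback-covers : ∀ S → Covers Y S → Covers X (pullback S)
  pullback-covers S cov v with cov (to v)
  ... | u , u∈S , inj₁ refl = v , u∈S , inj₁ refl
  ... | u , u∈S , inj₂ a = from u , subst (_∈ S) (sym eq) u∈S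
        , inj₂ (Equivalence.from (adj-iff (from u) v) (subst (λ z → Graph.Adj Y z (to v)) (sym eq) a))
    where eq = Inverse.inverseˡ vertex-bij {u} refl

module _ {X Y : Graph} (X≅Y : X ≅ Y) where

  open _≅_ X≅Y
  open Inverse vertex-bij using (to; from)

  pullback-minimal : ∀ S → Minimal Y S → Minimal X (pullback X≅Y S)
  pullback-minimal S min T cov T⊑S {u} u∈S = subst (_∈ T) (Inverse.inverseʳ vertex-bij refl)
    (min (pullback (≅-sym X≅Y) T) (pullback-covers (≅-sym X≅Y) T cov)
      (λ {v} v∈T → subst (_∈ S) (Inverse.inverseˡ vertex-bij refl) (T⊑S v∈T)) u∈S)

  WD-≅ : WD X → WD Y
  WD-≅ wd = record
    { γ = γ
    ; attained = pullback Y≅X S₀ , pullback-covers Y≅X S₀ cov₀ , trans (card-pullback Y≅X S₀) card≡γ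
    ; bound = λ S cov → subst (γ ≤_) (card-pullback X≅Y S)
        (bound (pullback X≅Y S) (pullback-covers X≅Y S cov))
    ; minimal≡γ = λ S cov min → trans (sym (card-pullback X≅Y S))
        (minimal≡γ (pullback X≅Y S) (pullback-covers X≅Y S cov) (pullback-minimal S min))
    }
    where
    open WD wd
    Y≅X = ≅-sym X≅Y
    S₀ = proj₁ attained
    cov₀ = proj₁ (proj₂ attained)
    card≡γ = proj₂ (proj₂ attained)

□-comm : ∀ X Y → (X □ Y) ≅ (Y □ X)
□-comm X Y = record
  { vertex-bij = mk↔ₛ′ (λ (x , y) → y , x) (λ (y , x) → x , y) (λ _ → refl) (λ _ → refl)
  ; adj-iff    = λ _ _ → mk⇔ (λ { (inj₁ (e , a)) → inj₂ (a , e) ; (inj₂ (a , e)) → inj₁ (e , a) })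
                             (λ { (inj₁ (e , a)) → inj₂ (a , e) ; (inj₂ (a , e)) → inj₁ (e , a) })
  }

-- The well-dominated products

module Rook (n : ℕ) where

  Rows : Sub (Fin n × Fin n) → Set
  Rows S = ∀ i → ∃[ j ] ((i , j) ∈ S)

  Columns : Sub (Fin n × Fin n) → Set
  Columns S = ∀ j → ∃[ i ] ((i , j) ∈ S)

  -- An empty row and an empty column would cross in a vertex without a dominator.
  rows-or-columns : ∀ S → Covers (K n □ K n) S → Rows S ⊎ Columns S
  rows-or-columns S cov with all? (K n) (λ i → any? (K n) λ j → mem? S (i , j))
                           | all? (K n) (λ j → any? (K n) λ i → mem? S (i , j))
  ... | inj₁ rows       | _               = inj₁ rows
  ... | inj₂ _          | inj₁ columns    = inj₂ columns
  ... | inj₂ (i₀ , ∄j)  | inj₂ (j₀ , ∄i) with cov (i₀ , j₀)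
  ...   | (i , j) , ij∈S , inj₁ refl              = contradiction (j , ij∈S) ∄j
  ...   | (i , j) , ij∈S , inj₂ (inj₁ (refl , _)) = contradiction (j , ij∈S) ∄j
  ...   | (i , j) , ij∈S , inj₂ (inj₂ (_ , refl)) = contradiction (i , ij∈S) ∄i

  graphOf : (Fin n → Fin n) → Sub (Fin n × Fin n)
  graphOf c = (λ (i , j) → j ≡ c i) given λ (i , j) → j Fin.≟ c i

  graphOf-covers : ∀ c → Covers (K n □ K n) (graphOf c)
  graphOf-covers c (i , j) with c i Fin.≟ j
  ... | yes e = (i , c i) , refl , inj₁ (cong (i ,_) e)
  ... | no ≢  = (i , c i) , refl , inj₂ (inj₁ (refl , ≢))

  card-graphOf : ∀ c → card (K n □ K n) (graphOf c) ≡ n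
  card-graphOf c = begin
    card (K n □ K n) (graphOf c)                    ≡⟨ ∑-□ (K n) (K n) _ ⟩
    (∑ (K n) λ i → ∑ (K n) λ j → ⟦ j Fin.≟ c i ⟧)
      ≡⟨ ∑-cong (K n) (λ i → ∑-point (K n) _ (c i)
           (⟦⟧-true (c i Fin.≟ c i) refl) λ j → ⟦⟧-false (j Fin.≟ c i)) ⟩
    (∑ (K n) λ _ → 1)                               ≡⟨ ∑-1 (K n) ⟩
    n                                               ∎
    where open ≡-Reasoning

  rows-graph : ∀ S → (rows : Rows S) → graphOf (proj₁ ∘ rows) ⊑ S
  rows-graph S rows {i , _} refl = proj₂ (rows i)

  rows-bound : ∀ S → Rows S → n ≤ card (K n □ K n) S
  rows-bound S rows = subst (_≤ card (K n □ K n) S) (card-graphOf (proj₁ ∘ rows))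
    (card-mono (K n □ K n) {graphOf _} {S} (rows-graph S rows))

  -- One chosen vertex per row already dominates, so a minimal set that meets every row is such a
  -- choice.
  rows-minimal : ∀ S → Rows S → Minimal (K n □ K n) S → card (K n □ K n) S ≡ n
  rows-minimal S rows min = trans
    (card-⊑⊒ (K n □ K n) {S} {graphOf c}
      (min (graphOf c) (graphOf-covers c) (rows-graph S rows)) (rows-graph S rows))
    (card-graphOf c)
    where c = proj₁ ∘ rows

  K□K-WD : WD (K n □ K n)
  K□K-WD = record
    { γ         = n
    ; attained  = graphOf (λ i → i) , graphOf-covers (λ i → i) , card-graphOf (λ i → i)
    ; bound     = λ S cov → [ rows-bound S , transposed-bound S ]′ (rows-or-columns S cov)
    ; minimal≡γ = λ S cov min →
        [ (λ rows → rows-minimal S rows min) , (λ columns → transposed-minimal S columns min) ]′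
          (rows-or-columns S cov)
    }
    where
    σ : (K n □ K n) ≅ (K n □ K n)
    σ = □-comm (K n) (K n)
    transposed-bound : ∀ S → Columns S → n ≤ card (K n □ K n) S
    transposed-bound S columns =
      subst (n ≤_) (card-pullback σ S) (rows-bound (pullback σ S) columns)
    transposed-minimal : ∀ S → Columns S → Minimal (K n □ K n) S → card (K n □ K n) S ≡ n
    transposed-minimal S columns min = trans (sym (card-pullback σ S))
      (rows-minimal (pullback σ S) columns (pullback-minimal σ S min))

-- The 512 vertex sets are checked by evaluation.
module P₃□K₃ where

  X : Graph
  X = P 3 □ K 3

  open Graph X using (adj?)

  ∀v : {P : Vertex X → Set} → Decidable P → Dec (∀ v → P v)
  ∀v P? = map′ (λ f (i , j) → f i j) (λ f i j → f (i , j))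
    (Fin.all? λ i → Fin.all? λ j → P? (i , j))

  ∃v : {P : Vertex X → Set} → Decidable P → Dec (∃[ v ] P v)
  ∃v P? = map′ (λ (i , j , p) → (i , j) , p) (λ ((i , j) , p) → i , j , p)
    (Fin.any? λ i → Fin.any? λ j → P? (i , j))

  dominating? : Decidable (Dominating X)
  dominating? S = ∀v λ v → (index X v Subset.∈? S) ⊎-dec
    (∃v λ u → (index X u Subset.∈? S) ×-dec adj? u v)

  minimal? : Decidable (MinimalDominating X)
  minimal? S = dominating? S ×-dec
    ∀v λ x → (index X x Subset.∈? S) →-dec ¬? (dominating? (remove X S x))

  bad? : Dec (∃[ S ] (Dominating X S × ((∣ S ∣ < 3) ⊎ (MinimalDominating X S × ∣ S ∣ ≢ 3))))
  bad? = Subset.anySubset? λ S → dominating? S ×-dec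
           ((∣ S ∣ ℕ.<? 3) ⊎-dec (minimal? S ×-dec ¬? (∣ S ∣ ℕ.≟ 3)))

  wellDominated : WellDominated X
  wellDominated =
      3
    , ( ( middle , from-yes (dominating? middle) , refl)
      , λ S dom → ℕ.≮⇒≥ λ small → no-bad (S , dom , inj₁ small))
    , λ S min → decidable-stable (∣ S ∣ ℕ.≟ 3) λ ≢3 → no-bad (S , proj₁ min , inj₂ (min , ≢3))
    where
    no-bad : ¬ _
    no-bad = toWitnessFalse {a? = bad?} _
    middle : VertexSet X
    middle = toSubset X ((λ (i , _) → i ≡ suc zero) given λ (i , _) → i Fin.≟ suc zero)

-- Dominating sets with external private neighbours

module _ {a p q} {A : Set a} {P : A → Set p} {Q : A → Set q} (μ : A → ℕ)
         (step : ∀ x → P x → Q x ⊎ ∃[ y ] (P y × μ y < μ x)) where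

  descend : ∀ x → P x → ∃[ y ] (P y × Q y)
  descend x = go x (<-wellFounded (μ x))
    where
    go : ∀ x → Acc _<_ (μ x) → P x → ∃[ y ] (P y × Q y)
    go x (acc rec) px with step x px
    ... | inj₁ qx            = x , px , qx
    ... | inj₂ (y , py , lt) = go y (rec lt) py

module _ (X : Graph) where

  open Graph X using (Adj; adj?; adj-sym; adj-irrefl)

  private
    _≟_ = eq? X

  -- The chosen dominators belong to the structure because the classes V_d are the fibres of
  -- `owner`; `owner-self` puts each d into its own class.
  record Tight (D : Sub (Vertex X)) : Set where
    field
      owner      : Vertex X → Vertex X
      owner∈     : ∀ v → owner v ∈ D
      owner-N    : ∀ v → N X (owner v) v
      owner-self : ∀ {d} → d ∈ D → owner d ≡ d
      external   : ∀ {d} → d ∈ D → ∃[ p ] (¬ p ∈ D × Adj d p × (∀ {d′} → d′ ∈ D → Adj d′ p → d′ ≡ d))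

  NoIsolated : Set
  NoIsolated = ∀ v → ∃[ u ] Adj v u

  private

    Private : Sub (Vertex X) → Vertex X → Vertex X → Set
    Private D d p = ¬ p ∈ D × Adj d p × ¬ (∃[ d′ ] (d′ ∈ D × Adj d′ p × d′ ≢ d))

    private? : ∀ D d → Dec (∃[ p ] Private D d p)
    private? D d = any? X λ p → ¬? (mem? D p) ×-dec adj? d p ×-dec
      ¬? (any? X λ d′ → mem? D d′ ×-dec adj? d′ p ×-dec ¬? (d′ ≟ d))

    Isolated : Sub (Vertex X) → Vertex X → Set
    Isolated D v = v ∈ D × ¬ (∃[ u ] (u ∈ D × Adj u v))

    isolated : Sub (Vertex X) → Sub (Vertex X)
    isolated D = Isolated D given λ v → mem? D v ×-dec ¬? (any? X λ u → mem? D u ×-dec adj? u v)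

    -- Lexicographic, since card X (isolated D) < suc (order X): a vertex d without
    -- an external private neighbour is either redundant, or isolated in D, and then
    -- exchanging it for a neighbour leaves fewer isolated vertices.
    μ : Sub (Vertex X) → ℕ
    μ D = card X D * suc (order X) + card X (isolated D)

    card-isolated≤order : ∀ D → card X (isolated D) ≤ order X
    card-isolated≤order D = subst (card X (isolated D) ≤_) (∑-1 X) (∑-mono X λ v → ⟦⟧≤1 (mem? (isolated D) v))

    without : Sub (Vertex X) → Vertex X → Sub (Vertex X)
    without D d = (λ v → v ∈ D × v ≢ d) given λ v → mem? D v ×-dec ¬? (v ≟ d)

    swapIn : Sub (Vertex X) → Vertex X → Vertex X → Sub (Vertex X)
    swapIn D d u = (λ v → v ≡ u ⊎ v ∈ D × v ≢ d) given λ v → (v ≟ u) ⊎-dec (mem? D v ×-dec ¬? (v ≟ d))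

    card-without : ∀ D {d} → d ∈ D → card X (without D d) < card X D
    card-without D {d} = card-strict X {without D d} {D} proj₁ λ (_ , d≢d) → d≢d refl

    card-swapIn : ∀ D {d u} → d ∈ D → card X (swapIn D d u) ≤ card X D
    card-swapIn D {d} {u} d∈D = ℕ.+-cancelʳ-≤ 1 _ _ (begin
      card X (swapIn D d u) + 1                                ≡⟨ cong (card X (swapIn D d u) +_) (sym (∑-δ X d)) ⟩
      card X (swapIn D d u) + (∑ X λ v → ⟦ v ≟ d ⟧)           ≡⟨ sym (∑-+ X _ _) ⟩
      (∑ X λ v → ⟦ mem? (swapIn D d u) v ⟧ + ⟦ v ≟ d ⟧)       ≤⟨ ∑-mono X pointwise ⟩
      (∑ X λ v → ⟦ mem? D v ⟧ + ⟦ v ≟ u ⟧)                    ≡⟨ ∑-+ X _ _ ⟩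
      card X D + (∑ X λ v → ⟦ v ≟ u ⟧)                        ≡⟨ cong (card X D +_) (∑-δ X u) ⟩
      card X D + 1                                             ∎)
      where
      open ℕ.≤-Reasoning
      pointwise : ∀ v → ⟦ mem? (swapIn D d u) v ⟧ + ⟦ v ≟ d ⟧ ≤ ⟦ mem? D v ⟧ + ⟦ v ≟ u ⟧
      pointwise v with mem? D v | v ≟ d | v ≟ u
      ... | yes _  | yes _    | yes _ = ℕ.≤-refl
      ... | yes _  | yes _    | no _  = ℕ.≤-refl
      ... | yes _  | no _     | yes _ = s≤s z≤n
      ... | yes _  | no _     | no _  = ℕ.≤-refl
      ... | no v∉D | yes refl | _     = contradiction d∈D v∉D
      ... | no _   | no _     | yes _ = ℕ.≤-refl
      ... | no _   | no _     | no _  = ℕ.≤-refl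

    module Step (noIsolated : NoIsolated) (D : Sub (Vertex X)) (cov : Covers X D)
                (d : Vertex X) (d∈D : d ∈ D) (¬priv : ¬ (∃[ p ] Private D d p)) where

      other-dominator : ∀ p → ¬ p ∈ D → Adj d p → ∃[ d′ ] (d′ ∈ D × Adj d′ p × d′ ≢ d)
      other-dominator p p∉D a = decidable-stable
        (any? X λ d′ → mem? D d′ ×-dec adj? d′ p ×-dec ¬? (d′ ≟ d))
        λ ∄d′ → ¬priv (p , p∉D , a , ∄d′)

      improvement : ∃[ D′ ] (Covers X D′ × μ D′ < μ D)
      improvement with any? X (λ u → mem? D u ×-dec adj? u d)
      -- Here d is redundant: u dominates it, and each of its neighbours outside D has a second
      -- dominator.
      ... | yes (u , u∈D , u~d) = without D d , cov′ , lt
        where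
        cov′ : Covers X (without D d)
        cov′ v with v ≟ d
        ... | yes refl = u , (u∈D , λ { refl → adj-irrefl refl u~d }) , inj₂ u~d
        ... | no v≢d with mem? D v
        ...   | yes v∈D = v , (v∈D , v≢d) , inj₁ refl
        ...   | no v∉D with cov v
        ...     | w , w∈D , inj₁ refl = contradiction w∈D v∉D
        ...     | w , w∈D , inj₂ w~v with w ≟ d
        ...       | no w≢d = w , (w∈D , w≢d) , inj₂ w~v
        ...       | yes refl with other-dominator v v∉D w~v
        ...         | d′ , d′∈D , a , d′≢d = d′ , (d′∈D , d′≢d) , inj₂ a
        lt : μ (without D d) < μ D
        lt = begin-strict
          card X (without D d) * suc (order X) + card X (isolated (without D d))
            ≤⟨ ℕ.+-monoʳ-≤ (card X (without D d) * suc (order X)) (card-isolated≤order (without D d)) ⟩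
          card X (without D d) * suc (order X) + order X
            <⟨ ℕ.+-monoʳ-< (card X (without D d) * suc (order X)) (ℕ.n<1+n (order X)) ⟩
          card X (without D d) * suc (order X) + suc (order X)
            ≡⟨ ℕ.+-comm _ (suc (order X)) ⟩
          suc (card X (without D d)) * suc (order X)
            ≤⟨ ℕ.*-monoˡ-≤ (suc (order X)) (card-without D d∈D) ⟩
          card X D * suc (order X)
            ≤⟨ ℕ.m≤m+n _ _ ⟩
          μ D ∎
          where open ℕ.≤-Reasoning
      ... | no d-isolated = D′ , cov′ , lt
        where
        u = proj₁ (noIsolated d)
        d~u = proj₂ (noIsolated d)
        u∉D : ¬ u ∈ D
        u∉D u∈D = d-isolated (u , u∈D , adj-sym d~u)
        D′ = swapIn D d u
        cov′ : Covers X D′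
        cov′ v with cov v
        ... | w , w∈D , Nwv with w ≟ d
        ...   | no w≢d = w , inj₂ (w∈D , w≢d) , Nwv
        cov′ v | w , w∈D , inj₁ refl | yes refl = u , inj₁ refl , inj₂ (adj-sym d~u)
        cov′ v | w , w∈D , inj₂ d~v | yes refl with other-dominator v (λ v∈D → d-isolated (v , v∈D , adj-sym d~v)) d~v
        ... | d′ , d′∈D , a , d′≢d = d′ , inj₂ (d′∈D , d′≢d) , inj₂ a
        -- The new vertex u is not isolated, since it has a dominator in D besides d. No other
        -- vertex becomes isolated, since d had no neighbour in D to lose.
        isolated′ : ∀ v → Isolated D′ v → Isolated D v
        isolated′ v (inj₁ refl , alone) with other-dominator v u∉D d~u
        ... | d′ , d′∈D , a , d′≢d = contradiction (d′ , inj₂ (d′∈D , d′≢d) , a) alone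
        isolated′ v (inj₂ (v∈D , v≢d) , alone) = v∈D , λ (w , w∈D , w~v) →
          alone (w , inj₂ (w∈D , λ { refl → d-isolated (v , v∈D , adj-sym w~v) }) , w~v)
        lt : μ D′ < μ D
        lt = ℕ.+-mono-≤-< (ℕ.*-monoˡ-≤ (suc (order X)) (card-swapIn D d∈D))
          (card-strict X {isolated D′} {isolated D} (λ {v} → isolated′ v)
            (λ { (inj₁ d≡u , _) → u∉D (subst (_∈ D) d≡u d∈D) ; (inj₂ (_ , d≢d) , _) → d≢d refl })
            (d∈D , d-isolated))

    Enough : Sub (Vertex X) → Set
    Enough D = ∀ d → d ∈ D → ∃[ p ] Private D d p

    step : NoIsolated → ∀ D → Covers X D → Enough D ⊎ ∃[ D′ ] (Covers X D′ × μ D′ < μ D)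
    step noIsolated D cov with any? X (λ d → mem? D d ×-dec ¬? (private? D d))
    ... | yes (d , d∈D , ¬priv) = inj₂ (Step.improvement noIsolated D cov d d∈D ¬priv)
    ... | no ∄d = inj₁ λ d d∈D → decidable-stable (private? D d) λ ¬priv → ∄d (d , d∈D , ¬priv)

    tight : ∀ D → Covers X D → Enough D → Tight D
    tight D cov enough = record
      { owner      = λ v → proj₁ (choice v)
      ; owner∈     = λ v → proj₁ (proj₂ (choice v))
      ; owner-N    = λ v → proj₁ (proj₂ (proj₂ (choice v)))
      ; owner-self = λ {d} → proj₂ (proj₂ (proj₂ (choice d)))
      ; external   = λ {d} d∈D → let (p , p∉D , d~p , unique) = enough d d∈D in
          p , p∉D , d~p , λ {d′} d′∈D d′~p →
            decidable-stable (d′ ≟ d) λ d′≢d → unique (d′ , d′∈D , d′~p , d′≢d)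
      }
      where
      choice : ∀ v → ∃[ u ] (u ∈ D × N X u v × (v ∈ D → u ≡ v))
      choice v with mem? D v
      ... | yes v∈D = v , v∈D , inj₁ refl , λ _ → refl
      ... | no v∉D  = let (u , u∈D , Nuv) = cov v in u , u∈D , Nuv , λ v∈D → contradiction v∈D v∉D

  bollobás-cockayne : NoIsolated → ∃[ D ] Tight D
  bollobás-cockayne noIsolated =
    let (D , cov , enough) = descend μ (step noIsolated) everything (λ v → v , tt , inj₁ refl)
    in D , tight D cov enough
    where
    everything : Sub (Vertex X)
    everything = (λ _ → ⊤) given (λ _ → yes tt)

  Independent : Sub (Vertex X) → Set
  Independent I = ∀ {u v} → u ∈ I → v ∈ I → ¬ Adj u v

  -- A maximal independent subset of C dominates C, because a vertex of C that it misses could be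
  -- added. The complement shrinks with each addition.
  extend-independent : ∀ C I₀ → I₀ ⊑ C → Independent I₀ →
    ∃[ I ] ((I₀ ⊑ I × I ⊑ C × Independent I) × (∀ {v} → v ∈ C → ∃[ i ] (i ∈ I × N X i v)))
  extend-independent C I₀ I₀⊑C indep₀ =
    descend (λ I → card X (complement I)) extend I₀ ((λ v∈ → v∈) , I₀⊑C , indep₀)
    where
    complement : Sub (Vertex X) → Sub (Vertex X)
    complement I = (λ v → ¬ v ∈ I) given λ v → ¬? (mem? I v)
    extend : ∀ I → I₀ ⊑ I × I ⊑ C × Independent I →
      (∀ {v} → v ∈ C → ∃[ i ] (i ∈ I × N X i v)) ⊎
      ∃[ J ] ((I₀ ⊑ J × J ⊑ C × Independent J) × card X (complement J) < card X (complement I))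
    extend I (I₀⊑I , I⊑C , indep)
      with any? X (λ v → mem? C v ×-dec ¬? (any? X λ i → mem? I i ×-dec N? X i v))
    ... | no ∄v = inj₁ λ {v} v∈C → decidable-stable (any? X λ i → mem? I i ×-dec N? X i v)
            λ ∄i → ∄v (v , v∈C , ∄i)
    ... | yes (v , v∈C , ∄i) = inj₂ (J , (inj₂ ∘ I₀⊑I , J⊑C , indepJ)
            , card-strict X {complement J} {complement I} (λ u∉J u∈I → u∉J (inj₂ u∈I))
                (λ v∉J → v∉J (inj₁ refl)) (λ v∈I → ∄i (v , v∈I , inj₁ refl)))
      where
      J : Sub (Vertex X)
      J = (λ u → u ≡ v ⊎ u ∈ I) given λ u → (u ≟ v) ⊎-dec mem? I u
      J⊑C : J ⊑ C
      J⊑C (inj₁ refl) = v∈C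
      J⊑C (inj₂ u∈I)  = I⊑C u∈I
      indepJ : Independent J
      indepJ (inj₁ refl) (inj₁ refl) = adj-irrefl refl
      indepJ (inj₁ refl) (inj₂ u∈I) a = ∄i (_ , u∈I , inj₂ (adj-sym a))
      indepJ (inj₂ u∈I) (inj₁ refl) a = ∄i (_ , u∈I , inj₂ a)
      indepJ (inj₂ u∈I) (inj₂ v∈I) = indep u∈I v∈I

-- Cardinalities in products

module _ (X : Graph) where

  ι : Sub (Vertex X) → Vertex X → ℕ
  ι S v = ⟦ mem? S v ⟧

module _ {A B : Set} where

  -- Sums of products f v * g w.  Comparing two of them pointwise compares the
  -- sizes of vertex sets of a product, by `count-≥` and `count-≤` below.
  eval : List ((A → ℕ) × (B → ℕ)) → A → B → ℕ
  eval []             v w = 0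
  eval ((f , g) ∷ ts) v w = f v * g w + eval ts v w

𝟏 : ∀ {A : Set} → A → ℕ
𝟏 _ = 1

module _ (G H : Graph) where

  private
    V = Vertex G
    W = Vertex H

  total : List ((V → ℕ) × (W → ℕ)) → ℕ
  total []             = 0
  total ((f , g) ∷ ts) = ∑ G f * ∑ H g + total ts

  ∑-eval : ∀ ts → (∑ G λ v → ∑ H λ w → eval ts v w) ≡ total ts
  ∑-eval [] = trans (∑-cong G λ v → ∑-*ˡ H 0 𝟏) (∑-*ˡ G 0 𝟏)
  ∑-eval ((f , g) ∷ ts) = begin
    (∑ G λ v → ∑ H λ w → f v * g w + eval ts v w)
      ≡⟨ ∑-cong G (λ v → trans (∑-+ H _ _) (cong (_+ ∑ H (eval ts v)) (∑-*ˡ H (f v) g))) ⟩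
    (∑ G λ v → f v * ∑ H g + ∑ H (eval ts v))
      ≡⟨ ∑-+ G _ _ ⟩
    (∑ G λ v → f v * ∑ H g) + (∑ G λ v → ∑ H (eval ts v))
      ≡⟨ cong₂ _+_ (∑-*ʳ G (∑ H g) f) (∑-eval ts) ⟩
    ∑ G f * ∑ H g + total ts ∎
    where open ≡-Reasoning

  card-□ : ∀ S ts → (∑ G λ v → ∑ H λ w → ⟦ mem? S (v , w) ⟧ + eval ts v w) ≡ card (G □ H) S + total ts
  card-□ S ts = begin
    (∑ G λ v → ∑ H λ w → ⟦ mem? S (v , w) ⟧ + eval ts v w)
      ≡⟨ ∑-cong G (λ v → ∑-+ H _ _) ⟩
    (∑ G λ v → (∑ H λ w → ⟦ mem? S (v , w) ⟧) + ∑ H (eval ts v))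
      ≡⟨ ∑-+ G _ _ ⟩
    (∑ G λ v → ∑ H λ w → ⟦ mem? S (v , w) ⟧) + (∑ G λ v → ∑ H (eval ts v))
      ≡⟨ cong₂ _+_ (sym (∑-□ G H λ vw → ⟦ mem? S vw ⟧)) (∑-eval ts) ⟩
    card (G □ H) S + total ts ∎
    where open ≡-Reasoning

  -- What has to be subtracted from the estimate of |S| stands in `rs`, so that no subtraction of
  -- natural numbers occurs.
  count-≥ : ∀ S ls rs → (∀ v w → eval ls v w ≤ ⟦ mem? S (v , w) ⟧ + eval rs v w) →
            total ls ≤ card (G □ H) S + total rs
  count-≥ S ls rs le = subst₂ _≤_ (∑-eval ls) (card-□ S rs) (∑-mono G λ v → ∑-mono H λ w → le v w)

  count-≤ : ∀ S ls rs → (∀ v w → ⟦ mem? S (v , w) ⟧ + eval ls v w ≤ eval rs v w) →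
            card (G □ H) S + total ls ≤ total rs
  count-≤ S ls rs le = subst₂ _≤_ (card-□ S ls) (∑-eval rs) (∑-mono G λ v → ∑-mono H λ w → le v w)

  cylinder : Sub V → Sub (V × W)
  cylinder D = (λ (v , _) → v ∈ D) given λ (v , _) → mem? D v

  card-cylinder : ∀ D → card (G □ H) (cylinder D) ≡ card G D * order H
  card-cylinder D = begin
    card (G □ H) (cylinder D)               ≡⟨ ∑-□ G H _ ⟩
    (∑ G λ v → ∑ H λ w → ι G D v)
      ≡⟨ ∑-cong G (λ v → ∑-cong H λ w → sym (trans (ℕ.+-identityʳ _) (ℕ.*-identityʳ _))) ⟩
    (∑ G λ v → ∑ H λ w → eval ts v w)       ≡⟨ ∑-eval ts ⟩
    card G D * ∑ H 𝟏 + 0                    ≡⟨ ℕ.+-identityʳ _ ⟩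
    card G D * ∑ H 𝟏                        ≡⟨ cong (card G D *_) (∑-1 H) ⟩
    card G D * order H                      ∎
    where
    open ≡-Reasoning
    ts : List ((V → ℕ) × (W → ℕ))
    ts = (ι G D , 𝟏) ∷ []

  N-row : ∀ {u v w} → N G u v → N (G □ H) (u , w) (v , w)
  N-row (inj₁ refl) = inj₁ refl
  N-row (inj₂ a)    = inj₂ (inj₂ (a , refl))

  N-column : ∀ {v w x} → N H w x → N (G □ H) (v , w) (v , x)
  N-column (inj₁ refl) = inj₁ refl
  N-column (inj₂ a)    = inj₂ (inj₁ (refl , a))

  module _ (S : Sub (V × W)) where

    PrivateAt : V → W → Set
    PrivateAt v w = ∃[ x ] (N (G □ H) (v , w) x × (∀ x′ → x′ ∈ S → N (G □ H) x′ x → x′ ≡ (v , w)))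

    -- The closed neighbourhood of (p , w) consists of a part of its row V × {w} and a part of its
    -- column {p} × W, and the two hypotheses treat these separately. The column may meet S near (p
    -- , w) only in (v , w) itself, which forces p ≡ v.
    private-in-row : ∀ {v w} p → N G v p →
      (∀ {v′} → (v′ , w) ∈ S → N G v′ p → v′ ≡ v) →
      (∀ {w′} → (p , w′) ∈ S → N H w′ w → p ≡ v × w′ ≡ w) →
      PrivateAt v w
    private-in-row {v} {w} p Nvp row column = (p , w) , N-row Nvp , λ
      { (v′ , w′) s (inj₁ refl) → cong (_, w) (row s (inj₁ refl))
      ; (v′ , w′) s (inj₂ (inj₁ (refl , a))) → let (e , e′) = column s (inj₂ a) in cong₂ _,_ e e′
      ; (v′ , w′) s (inj₂ (inj₂ (a , refl))) → cong (_, w) (row s (inj₂ a))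
      }

    private-in-column : ∀ {v w} q → N H w q →
      (∀ {v′} → (v′ , q) ∈ S → N G v′ v → v′ ≡ v × q ≡ w) →
      (∀ {w′} → (v , w′) ∈ S → N H w′ q → w′ ≡ w) →
      PrivateAt v w
    private-in-column {v} {w} q Nwq row column = (v , q) , N-column Nwq , λ
      { (v′ , w′) s (inj₁ refl) → cong (v ,_) (column s (inj₁ refl))
      ; (v′ , w′) s (inj₂ (inj₁ (refl , a))) → cong (v ,_) (column s (inj₂ a))
      ; (v′ , w′) s (inj₂ (inj₂ (a , refl))) → let (e , e′) = row s (inj₂ a) in cong₂ _,_ e e′
      }

  module _ (wd : WD (G □ H)) where

    open WD wd

    private-card : ∀ S → (∀ v w → ∃[ u ] (u ∈ S × N (G □ H) u (v , w))) →
      (∀ {v w} → (v , w) ∈ S → PrivateAt S v w) → card (G □ H) S ≡ γ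
    private-card S cov priv = minimal≡γ S (uncurry cov)
      (irredundant⇒minimal (G □ H) {S} λ _ → priv)

    -- The private neighbour of (d , w) is (p , w) with p external to D: the whole column of p then
    -- avoids D × H. A vertex d that is private only to itself would not do, since its column lies
    -- in D × H.
    tight-card : ∀ {D} → Tight G D → card G D * order H ≡ γ
    tight-card {D} tight = trans (sym (card-cylinder D)) (private-card (cylinder D)
      (λ v w → (owner v , w) , owner∈ v , N-row (owner-N v))
      λ {v} {w} v∈D → let (p , p∉D , v~p , unique) = external v∈D in
        private-in-row (cylinder D) p (inj₂ v~p)
          (λ { v′∈D (inj₁ refl) → contradiction v′∈D p∉D ; v′∈D (inj₂ a) → unique v′∈D a })
          (λ p∈D _ → contradiction p∈D p∉D))
      where open Tight tight

-- Exchanging fibres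

fibre : ∀ {A : Set} X → (A → Vertex X) → Vertex X → Sub A
fibre X r d = (λ a → r a ≡ d) given λ a → eq? X (r a) d

by-evaluation : ∀ {m n} {{_ : T (m ≤ᵇ n)}} → m ≤ n
by-evaluation {m} {n} {{m≤n}} = ℕ.≤ᵇ⇒≤ m n m≤n

module _ (G H : Graph) where

  private
    V = Vertex G
    W = Vertex H

  -- Otherwise trading {d} × W_e for V_d × {e} would give too small a cover.
  exchange : WD (G □ H) → ∀ {D} → Tight G D →
             (r : V → V) → (∀ v → r v ∈ D) → (∀ v → N G (r v) v) →
             (s : W → W) → (∀ w → N H (s w) w) →
             ∀ {d} e → d ∈ D → card H (fibre H s e) ≤ card G (fibre G r d)
  exchange wd {D} tight r r∈D r-N s s-N {d} e d∈D = finish (count-≤ G H S ls rs pointwise)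
    where
    open WD wd
    W_e = fibre H s e
    V_d = fibre G r d
    S : Sub (V × W)
    S = (λ (v , w) → v ∈ D × ¬ (v ≡ d × s w ≡ e) ⊎ r v ≡ d × w ≡ e)
        given λ (v , w) → (mem? D v ×-dec ¬? (eq? G v d ×-dec eq? H (s w) e))
          ⊎-dec (eq? G (r v) d ×-dec eq? H w e)
    cov : Covers (G □ H) S
    cov (v , w) with eq? H (s w) e | eq? G (r v) d
    ... | no ≢e  | _        = (r v , w) , inj₁ (r∈D v , ≢e ∘ proj₂) , N-row G H (r-N v)
    ... | yes _  | no ≢d    = (r v , w) , inj₁ (r∈D v , ≢d ∘ proj₁) , N-row G H (r-N v)
    -- In the rows over W_e only the vertices of V_d have lost their owner; they are dominated along
    -- their columns, because e dominates all of W_e.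
    ... | yes eq | yes rv≡d = (v , e) , inj₂ (rv≡d , refl) , N-column G H (subst (λ x → N H x w) eq (s-N w))
    ls rs : List ((V → ℕ) × (W → ℕ))
    ls = (δ G d , ι H W_e) ∷ []
    rs = (ι G D , 𝟏) ∷ (ι G V_d , δ H e) ∷ []
    pointwise : ∀ v w → ⟦ mem? S (v , w) ⟧ + eval ls v w ≤ eval rs v w
    pointwise v w with mem? D v | eq? G v d | eq? H (s w) e | eq? G (r v) d | eq? H w e
    ... | no v∉D | yes refl | _     | _     | _     = contradiction d∈D v∉D
    ... | no _   | no _     | _     | yes _ | yes _ = by-evaluation
    ... | no _   | no _     | _     | yes _ | no _  = by-evaluation
    ... | no _   | no _     | _     | no _  | _     = by-evaluation
    ... | yes _  | no _     | _     | _     | _     = by-evaluation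
    ... | yes _  | yes _    | no _  | _     | _     = by-evaluation
    ... | yes _  | yes _    | yes _ | yes _ | yes _ = by-evaluation
    ... | yes _  | yes _    | yes _ | yes _ | no _  = by-evaluation
    ... | yes _  | yes _    | yes _ | no _  | _     = by-evaluation
    finish : card (G □ H) S + (∑ G (δ G d) * card H W_e + 0)
             ≤ card G D * ∑ H 𝟏 + (card G V_d * ∑ H (δ H e) + 0) → card H W_e ≤ card G V_d
    finish le rewrite ∑-δ G d | ∑-δ H e | ∑-1 H | tight-card G H wd tight =
      ℕ.+-cancelˡ-≤ γ _ _ (subst₂ _≤_ (lhs γ (card H W_e)) (rhs γ (card G V_d))
        (ℕ.≤-trans (ℕ.+-monoˡ-≤ _ (bound S cov)) le))
      where
      lhs : ∀ γ a → γ + (1 * a + 0) ≡ γ + a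
      lhs = solve-∀
      rhs : ∀ γ b → γ + (b * 1 + 0) ≡ γ + b
      rhs = solve-∀

-- A factor of a well-dominated product

module Factor (G H : Graph) (wd : WD (G □ H)) (E : Sub (Vertex H)) (tightE : Tight H E) (w₀ : Vertex H) where

  open WD wd
  open Graph G using (Adj; adj-sym; adj-irrefl)
  open Tight tightE using () renaming
    (owner to s; owner∈ to s∈E; owner-N to s-N; owner-self to s-self; external to externalE)

  private
    V = Vertex G
    W = Vertex H
    _≟_ = eq? G

  e : W
  e = s w₀

  e∈E : e ∈ E
  e∈E = s∈E w₀

  -- Measured in H, where the assignment `s` stays fixed, so that the same number serves for all D
  -- and all assignments in G.
  k : ℕ
  k = card H (fibre H s e)

  0<|E| : 0 < card H E
  0<|E| = subst (_≤ card H E) (⟦⟧-true (mem? E e) e∈E) (term≤∑ H (ι H E) e)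

  private-of : ∀ {f} → f ∈ E → ∃[ p ] (N H f p × f ≢ p × ¬ p ∈ E × (∀ {w} → w ∈ E → N H w p → w ≡ f))
  private-of f∈E with externalE f∈E
  ... | p , p∉E , f~p , unique = p , inj₂ f~p , (λ { refl → p∉E f∈E }) , p∉E ,
    λ { w∈E (inj₁ refl) → contradiction w∈E p∉E ; w∈E (inj₂ a) → unique w∈E a }

  -- The second inequality of the pair is `exchange` applied to G □ H, the first to H □ G with E in
  -- the role of D. The assignment `r` is arbitrary and need not be the owner map of `tightD`; this
  -- freedom is what makes D a perfect code.
  fibre-size : ∀ {D} → Tight G D → (r : V → V) → (∀ v → r v ∈ D) → (∀ v → N G (r v) v) →
               ∀ {d} → d ∈ D → card G (fibre G r d) ≡ k
  fibre-size tightD r r∈D r-N {d} d∈D = ℕ.≤-antisym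
    (exchange H G (WD-≅ (□-comm G H) wd) tightE s s∈E s-N r r-N d e∈E)
    (exchange G H wd tightD r r∈D r-N s s-N e d∈D)

  module Code (D : Sub V) (tightD : Tight G D) where

    open Tight tightD renaming (owner to r; owner∈ to r∈D; owner-N to r-N; owner-self to r-self)

    |D|m≡γ : card G D * order H ≡ γ
    |D|m≡γ = tight-card G H wd tightD

    -- For d ∈ D this is the open neighbourhood of d, by `C-adj` and `unique-owner`.
    C : V → Sub V
    C d = (λ v → r v ≡ d × v ≢ d) given λ v → (r v ≟ d) ×-dec ¬? (v ≟ d)

    -- Reassigning v to d would enlarge the fibre of d.
    unique-owner : ∀ {d v} → d ∈ D → N G d v → r v ≡ d
    unique-owner {d} {v} d∈D Ndv = decidable-stable (r v ≟ d) λ rv≢d → ℕ.<-irrefl refl (begin-strict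
      k                                                ≡⟨ sym (fibre-size tightD r r∈D r-N d∈D) ⟩
      card G (fibre G r d)
        <⟨ card-strict G {fibre G r d} {fibre G r′ d} (λ {u} → grow u) rv≢d r′v≡d ⟩
      card G (fibre G r′ d)                            ≡⟨ fibre-size tightD r′ r′∈D r′-N d∈D ⟩
      k                                                ∎)
      where
      open ℕ.≤-Reasoning
      choice : ∀ u → ∃[ c ] (c ∈ D × N G c u × (u ≡ v → c ≡ d) × (u ≢ v → c ≡ r u))
      choice u with u ≟ v
      ... | yes refl = d , d∈D , Ndv , (λ _ → refl) , λ u≢u → contradiction refl u≢u
      ... | no u≢v   = r u , r∈D u , r-N u , (λ u≡v → contradiction u≡v u≢v) , λ _ → refl
      r′ : V → V
      r′ u = proj₁ (choice u)
      r′∈D : ∀ u → r′ u ∈ D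
      r′∈D u = proj₁ (proj₂ (choice u))
      r′-N : ∀ u → N G (r′ u) u
      r′-N u = proj₁ (proj₂ (proj₂ (choice u)))
      r′v≡d : r′ v ≡ d
      r′v≡d = proj₁ (proj₂ (proj₂ (proj₂ (choice v)))) refl
      grow : ∀ u → r u ≡ d → r′ u ≡ d
      grow u ru≡d with _ , _ , _ , at-v , elsewhere ← choice u =
        [ at-v , (λ u≢v → trans (elsewhere u≢v) ru≡d) ]′ (toSum (u ≟ v))

    dominator-unique : ∀ {c d v} → c ∈ D → N G c v → r v ≡ d → c ≡ d
    dominator-unique c∈D Ncv = trans (sym (unique-owner c∈D Ncv))

    C-∉ : ∀ {d v} → v ∈ C d → ¬ v ∈ D
    C-∉ (refl , v≢d) v∈D = v≢d (sym (r-self v∈D))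

    C-adj : ∀ {d v} → v ∈ C d → Adj d v
    C-adj {d} {v} (refl , v≢d) with r-N v
    ... | inj₁ rv≡v = contradiction (sym rv≡v) v≢d
    ... | inj₂ a    = a

    order≡|D|k : order G ≡ card G D * k
    order≡|D|k = begin
      order G                                            ≡⟨ sym (∑-1 G) ⟩
      (∑ G λ _ → 1)
        ≡⟨ ∑-cong G (λ v → sym (∑-point G _ (r v) (owned v) (not-owned v))) ⟩
      (∑ G λ v → ∑ G λ d → ι G D d * ⟦ r v ≟ d ⟧)        ≡⟨ ∑-swap G G _ ⟩
      (∑ G λ d → ∑ G λ v → ι G D d * ⟦ r v ≟ d ⟧)
        ≡⟨ ∑-cong G (λ d → trans (∑-*ˡ G (ι G D d) _) (size d)) ⟩
      (∑ G λ d → ι G D d * k)                            ≡⟨ ∑-*ʳ G k (ι G D) ⟩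
      card G D * k                                       ∎
      where
      open ≡-Reasoning
      owned : ∀ v → ι G D (r v) * ⟦ r v ≟ r v ⟧ ≡ 1
      owned v = cong₂ _*_ (⟦⟧-true (mem? D (r v)) (r∈D v)) (⟦⟧-true (r v ≟ r v) refl)
      not-owned : ∀ v d → d ≢ r v → ι G D d * ⟦ r v ≟ d ⟧ ≡ 0
      not-owned v d d≢ = trans (cong (ι G D d *_) (⟦⟧-false (r v ≟ d) (d≢ ∘ sym))) (ℕ.*-zeroʳ (ι G D d))
      size : ∀ d → ι G D d * card G (fibre G r d) ≡ ι G D d * k
      size d with mem? D d
      ... | yes d∈D = cong (1 *_) (fibre-size tightD r r∈D r-N d∈D)
      ... | no _    = refl

    -- Otherwise, in the rows over W_e, V ∖ V_d times {e} and {d} times W_e ∖ {e} suffice.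
    inner : ∀ {d} → d ∈ D → ∃[ u ] (u ∈ C d × (∀ {v} → N G v u → r v ≡ d))
    inner {d} d∈D with any? G (λ u → mem? (C d) u ×-dec ¬? (any? G λ v → N? G v u ×-dec ¬? (r v ≟ d)))
    ... | yes (u , u∈C , ∄v) = u , u∈C , λ {v} Nvu → decidable-stable (r v ≟ d) λ ≢d → ∄v (v , Nvu , ≢d)
    ... | no ∄u = contradiction (count-≤ G H S ls rs pointwise) too-small
      where
      W_e = fibre H s e
      V_d = fibre G r d
      S : Sub (V × W)
      S = (λ (v , w) → (v ∈ D × s w ≢ e) ⊎ (v ≡ d × w ≢ e) ⊎ (r v ≢ d × w ≡ e))
          given λ (v , w) → (mem? D v ×-dec ¬? (eq? H (s w) e)) ⊎-dec
            ((v ≟ d) ×-dec ¬? (eq? H w e)) ⊎-dec (¬? (r v ≟ d) ×-dec eq? H w e)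
      leaves-fibre : ∀ u → u ∈ C d → ∃[ v ] (N G v u × r v ≢ d)
      leaves-fibre u u∈C = decidable-stable (any? G λ v → N? G v u ×-dec ¬? (r v ≟ d)) λ ∄v → ∄u (u , u∈C , ∄v)
      cov : Covers (G □ H) S
      cov (v , w) with eq? H (s w) e
      ... | no sw≢e = (r v , w) , inj₁ (r∈D v , sw≢e) , N-row G H (r-N v)
      ... | yes sw≡e with r v ≟ d
      ...   | no rv≢d = (v , e) , inj₂ (inj₂ (rv≢d , refl)) , N-column G H (subst (λ x → N H x w) sw≡e (s-N w))
      ...   | yes rv≡d with eq? H w e
      ...     | no w≢e = (d , w) , inj₂ (inj₁ (refl , w≢e)) , N-row G H (subst (λ x → N G x v) rv≡d (r-N v))
      ...     | yes refl with v ≟ d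
      -- The row of e contains nothing over V_d, so (v , e) needs a neighbour in that row outside
      -- the class; the negated claim supplies one.
      ...       | no v≢d = let (v′ , Nv′v , rv′≢d) = leaves-fibre v (rv≡d , v≢d) in
                    (v′ , w) , inj₂ (inj₂ (rv′≢d , refl)) , N-row G H Nv′v
      -- Only (d , e) is left. It is dominated along its column, since e has a neighbour p ≢ e.
      ...       | yes refl = let (p , Nep , e≢p , _) = private-of e∈E in
                    (d , p) , inj₂ (inj₁ (refl , e≢p ∘ sym)) , N-column G H (N-sym H Nep)
      ls rs : List ((V → ℕ) × (W → ℕ))
      ls = (ι G D , ι H W_e) ∷ (δ G d , δ H e) ∷ (ι G V_d , δ H e) ∷ []
      rs = (ι G D , 𝟏) ∷ (δ G d , ι H W_e) ∷ (𝟏 , δ H e) ∷ []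
      pointwise : ∀ v w → ⟦ mem? S (v , w) ⟧ + eval ls v w ≤ eval rs v w
      pointwise v w with eq? H w e | eq? H (s w) e | v ≟ d | mem? D v | r v ≟ d
      ... | yes refl | no se≢e | _        | _      | _       = contradiction (s-self e∈E) se≢e
      ... | yes refl | yes _   | yes refl | no d∉D | _       = contradiction d∈D d∉D
      ... | yes refl | yes _   | yes refl | yes _  | no rd≢d = contradiction (r-self d∈D) rd≢d
      ... | yes refl | yes _   | yes refl | yes _  | yes _   = by-evaluation
      ... | yes refl | yes _   | no _     | yes _  | yes _   = by-evaluation
      ... | yes refl | yes _   | no _     | yes _  | no _    = by-evaluation
      ... | yes refl | yes _   | no _     | no _   | yes _   = by-evaluation
      ... | yes refl | yes _   | no _     | no _   | no _    = by-evaluation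
      ... | no _     | yes _   | yes refl | no d∉D | _       = contradiction d∈D d∉D
      ... | no _     | yes _   | yes refl | yes _  | yes _   = by-evaluation
      ... | no _     | yes _   | yes refl | yes _  | no _    = by-evaluation
      ... | no _     | yes _   | no _     | yes _  | yes _   = by-evaluation
      ... | no _     | yes _   | no _     | yes _  | no _    = by-evaluation
      ... | no _     | yes _   | no _     | no _   | yes _   = by-evaluation
      ... | no _     | yes _   | no _     | no _   | no _    = by-evaluation
      ... | no _     | no _    | yes refl | no d∉D | _       = contradiction d∈D d∉D
      ... | no _     | no _    | yes refl | yes _  | yes _   = by-evaluation
      ... | no _     | no _    | yes refl | yes _  | no _    = by-evaluation
      ... | no _     | no _    | no _     | yes _  | yes _   = by-evaluation
      ... | no _     | no _    | no _     | yes _  | no _    = by-evaluation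
      ... | no _     | no _    | no _     | no _   | yes _   = by-evaluation
      ... | no _     | no _    | no _     | no _   | no _    = by-evaluation
      -- The size of S is at most γ - |D|k + (k - 1) + (|D|k - k) = γ - 1.
      too-small : ¬ card (G □ H) S
                    + (card G D * k + (∑ G (δ G d) * ∑ H (δ H e) + (card G V_d * ∑ H (δ H e) + 0)))
                  ≤ card G D * ∑ H 𝟏 + (∑ G (δ G d) * k + (∑ G 𝟏 * ∑ H (δ H e) + 0))
      too-small le
        rewrite ∑-δ G d | ∑-δ H e | ∑-1 G | ∑-1 H | |D|m≡γ | fibre-size tightD r r∈D r-N d∈D
          | order≡|D|k
        = ℕ.<-irrefl refl (subst₂ _≤_ (lhs (card G D * k) k γ) (rhs (card G D * k) k γ)
            (ℕ.≤-trans (ℕ.+-monoˡ-≤ _ (bound S cov)) le))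
        where
        lhs : ∀ n k γ → γ + (n + (1 * 1 + (k * 1 + 0))) ≡ suc (γ + k + n)
        lhs = solve-∀
        rhs : ∀ n k γ → γ + (1 * k + (n * 1 + 0)) ≡ γ + k + n
        rhs = solve-∀

    -- D × H with {d} × {w₀} traded for I × {w₀} is a minimal dominating set.
    module Independents {d} (d∈D : d ∈ D) (I : Sub V) (I⊑C : I ⊑ C d) (indep : Independent G I)
      (dominates : ∀ {v} → v ∈ C d → ∃[ i ] (i ∈ I × N G i v))
      {x} (x∈I : x ∈ I) {z} (z∈C : z ∈ C d) (z∉I : ¬ z ∈ I) where

      S : Sub (V × W)
      S = (λ (v , w) → (v ∈ D × ¬ (v ≡ d × w ≡ w₀)) ⊎ (v ∈ I × w ≡ w₀))
          given λ (v , w) → (mem? D v ×-dec ¬? ((v ≟ d) ×-dec eq? H w w₀)) ⊎-dec (mem? I v ×-dec eq? H w w₀)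

      cov : Covers (G □ H) S
      cov (v , w) with r v ≟ d | eq? H w w₀
      ... | no rv≢d  | _        = (r v , w) , inj₁ (r∈D v , rv≢d ∘ proj₁) , N-row G H (r-N v)
      ... | yes _    | no w≢w₀  = (r v , w) , inj₁ (r∈D v , w≢w₀ ∘ proj₂) , N-row G H (r-N v)
      ... | yes rv≡d | yes refl with v ≟ d
      ...   | yes refl = (x , w) , inj₂ (x∈I , refl) , N-row G H (inj₂ (adj-sym (C-adj (I⊑C x∈I))))
      ...   | no v≢d   = let (i , i∈I , Niv) = dominates (rv≡d , v≢d) in
                         (i , w) , inj₂ (i∈I , refl) , N-row G H Niv

      priv : ∀ {v w} → (v , w) ∈ S → PrivateAt G H S v w
      priv {v} {w} (inj₂ (v∈I , refl)) = private-in-row G H S v (inj₁ refl)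
        (λ { (inj₁ (v′∈D , ¬dw₀)) Nv′v →
               contradiction (dominator-unique v′∈D Nv′v (proj₁ (I⊑C v∈I)) , refl) ¬dw₀
           ; (inj₂ (v′∈I , _)) (inj₁ v′≡v) → v′≡v
           ; (inj₂ (v′∈I , _)) (inj₂ a) → contradiction a (indep v′∈I v∈I) })
        (λ { (inj₁ (v∈D , _)) _ → contradiction v∈D (C-∉ (I⊑C v∈I))
           ; (inj₂ (_ , w′≡w₀)) _ → refl , w′≡w₀ })
      priv {v} {w} (inj₁ (v∈D , ¬dw₀)) with v ≟ d
      -- For w ≢ w₀ the vertex (d , w) keeps (z , w) as private neighbour: the column of z misses S
      -- because z lies outside both D and I.
      ... | yes refl = private-in-row G H S z (inj₂ (C-adj z∈C))
        (λ { (inj₁ (v′∈D , _)) Nv′z → dominator-unique v′∈D Nv′z (proj₁ z∈C)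
           ; (inj₂ (_ , w≡w₀)) _ → contradiction (refl , w≡w₀) ¬dw₀ })
        (λ { (inj₁ (z∈D , _)) _ → contradiction z∈D (C-∉ z∈C)
           ; (inj₂ (z∈I , _)) _ → contradiction z∈I z∉I })
      -- The new vertices I lie in the class of d and so have no neighbour at the inner vertex of
      -- another class.
      ... | no v≢d with inner v∈D
      ...   | u , u∈C , within = private-in-row G H S u (inj₂ (C-adj u∈C))
        (λ { (inj₁ (v′∈D , _)) Nv′u → dominator-unique v′∈D Nv′u (proj₁ u∈C)
           ; (inj₂ (v′∈I , _)) Nv′u → contradiction (trans (sym (within Nv′u)) (proj₁ (I⊑C v′∈I))) v≢d })
        (λ { (inj₁ (u∈D , _)) _ → contradiction u∈D (C-∉ u∈C)
           ; (inj₂ (u∈I , _)) _ → contradiction (trans (sym (proj₁ u∈C)) (proj₁ (I⊑C u∈I))) v≢d })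

      ls rs : List ((V → ℕ) × (W → ℕ))
      ls = (ι G D , 𝟏) ∷ (ι G I , δ H w₀) ∷ []
      rs = (δ G d , δ H w₀) ∷ []

      pointwise : ∀ v w → eval ls v w ≤ ⟦ mem? S (v , w) ⟧ + eval rs v w
      pointwise v w with eq? H w w₀ | v ≟ d | mem? I v | mem? D v
      ... | yes _ | yes refl | yes d∈I | _     = contradiction d∈D (C-∉ (I⊑C d∈I))
      ... | yes _ | yes refl | no _    | yes _ = by-evaluation
      ... | yes _ | yes refl | no _    | no _  = by-evaluation
      ... | yes _ | no _     | yes v∈I | yes v∈D = contradiction v∈D (C-∉ (I⊑C v∈I))
      ... | yes _ | no _     | yes _   | no _  = by-evaluation
      ... | yes _ | no _     | no _    | yes _ = by-evaluation
      ... | yes _ | no _     | no _    | no _  = by-evaluation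
      ... | no _  | yes _    | yes _   | yes _ = by-evaluation
      ... | no _  | yes _    | yes _   | no _  = by-evaluation
      ... | no _  | yes _    | no _    | yes _ = by-evaluation
      ... | no _  | yes _    | no _    | no _  = by-evaluation
      ... | no _  | no _     | yes _   | yes _ = by-evaluation
      ... | no _  | no _     | yes _   | no _  = by-evaluation
      ... | no _  | no _     | no _    | yes _ = by-evaluation
      ... | no _  | no _     | no _    | no _  = by-evaluation

      -- The trade removes one vertex and adds |I|, while the size has to remain γ.
      card≤1 : card G I ≤ 1
      card≤1 = finish (count-≥ G H S ls rs pointwise)
        where
        finish : card G D * ∑ H 𝟏 + (card G I * ∑ H (δ H w₀) + 0)
                 ≤ card (G □ H) S + (∑ G (δ G d) * ∑ H (δ H w₀) + 0) → card G I ≤ 1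
        finish le rewrite ∑-δ G d | ∑-δ H w₀ | ∑-1 H | |D|m≡γ
          | private-card G H wd S (λ v w → cov (v , w)) priv =
          subst (_≤ 1) (trans (ℕ.+-identityʳ _) (ℕ.*-identityʳ _)) (ℕ.+-cancelˡ-≤ γ _ _ le)

    -- Extend {x , y} to a maximal independent subset I of C d. An edge b c inside C d would have an
    -- end outside I, which is the z needed for `Independents`, and then |I| ≤ 1 contradicts x ≢ y.
    star : ∀ {d x y} → d ∈ D → x ∈ C d → y ∈ C d → ¬ N G x y → Independent G (C d)
    star {d} {x} {y} d∈D x∈C y∈C ¬Nxy {b} {c} b∈C c∈C b~c
      with extend-independent G (C d) I₀ I₀⊑C indep₀
      where
      I₀ : Sub V
      I₀ = (λ v → v ≡ x ⊎ v ≡ y) given λ v → (v ≟ x) ⊎-dec (v ≟ y)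
      I₀⊑C : I₀ ⊑ C d
      I₀⊑C (inj₁ refl) = x∈C
      I₀⊑C (inj₂ refl) = y∈C
      indep₀ : Independent G I₀
      indep₀ (inj₁ refl) (inj₁ refl) = adj-irrefl refl
      indep₀ (inj₁ refl) (inj₂ refl) = ¬Nxy ∘ inj₂
      indep₀ (inj₂ refl) (inj₁ refl) = ¬Nxy ∘ inj₂ ∘ adj-sym
      indep₀ (inj₂ refl) (inj₂ refl) = adj-irrefl refl
    ... | I , (I₀⊑I , I⊑C , indep) , dominates = z-case (mem? I b)
      where
      x∈I = I₀⊑I (inj₁ refl)
      conclude : ∀ {z} → z ∈ C d → ¬ z ∈ I → _
      conclude z∈C z∉I = contradiction
        (ℕ.≤-trans (two≤card G {I} x∈I (I₀⊑I (inj₂ refl)) (¬Nxy ∘ inj₁))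
          (Independents.card≤1 d∈D I I⊑C indep dominates x∈I z∈C z∉I)) λ { (s≤s ()) }
      z-case : Dec (b ∈ I) → _
      z-case (no b∉I)  = conclude b∈C b∉I
      z-case (yes b∈I) = conclude c∈C λ c∈I → indep b∈I c∈I b~c

    -- ((D ∖ {d}) × H) ∪ ({a} × (H ∖ E)) ∪ ((C d ∖ {a}) × E) is a minimal dominating
    -- set of size at least γ + |E|.
    module ThreeLeaves {d} (d∈D : d ∈ D) (indep : Independent G (C d)) {a b b′}
      (a∈C : a ∈ C d) (b∈C : b ∈ C d) (b′∈C : b′ ∈ C d) (a≢b : a ≢ b) (a≢b′ : a ≢ b′) (b≢b′ : b ≢ b′) where

      S : Sub (V × W)
      S = (λ (v , w) → (v ∈ D × v ≢ d) ⊎ (v ≡ a × ¬ w ∈ E) ⊎ ((v ∈ C d × v ≢ a) × w ∈ E))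
          given λ (v , w) → (mem? D v ×-dec ¬? (v ≟ d)) ⊎-dec ((v ≟ a) ×-dec ¬? (mem? E w)) ⊎-dec
            ((mem? (C d) v ×-dec ¬? (v ≟ a)) ×-dec mem? E w)

      cov : Covers (G □ H) S
      cov (v , w) with r v ≟ d | v ≟ d | mem? E w
      ... | no rv≢d  | _        | _       = (r v , w) , inj₁ (r∈D v , rv≢d) , N-row G H (r-N v)
      ... | yes _    | yes refl | no w∉E  = (a , w) , inj₂ (inj₁ (refl , w∉E)) ,
                                        N-row G H (inj₂ (adj-sym (C-adj a∈C)))
      ... | yes _    | yes refl | yes w∈E = (b , w) , inj₂ (inj₂ ((b∈C , a≢b ∘ sym) , w∈E)) ,
                                        N-row G H (inj₂ (adj-sym (C-adj b∈C)))
      ... | yes rv≡d | no v≢d   | w∈E? with v ≟ a | w∈E?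
      ...   | no v≢a   | _       = (v , s w) , inj₂ (inj₂ (((rv≡d , v≢d) , v≢a) , s∈E w)) , N-column G H (s-N w)
      ...   | yes refl | no w∉E  = (a , w) , inj₂ (inj₁ (refl , w∉E)) , inj₁ refl
      -- The complement of E dominates E, since each vertex of E has an external neighbour.
      ...   | yes refl | yes w∈E = let (p , Nwp , _ , p∉E , _) = private-of w∈E in
                                   (a , p) , inj₂ (inj₁ (refl , p∉E)) , N-column G H (N-sym H Nwp)

      in-C : ∀ {v w} → (v , w) ∈ S → ¬ v ∈ D → v ∈ C d
      in-C (inj₁ (v∈D , _)) v∉D = contradiction v∈D v∉D
      in-C (inj₂ (inj₁ (refl , _))) _ = a∈C
      in-C (inj₂ (inj₂ ((v∈C , _) , _))) _ = v∈C

      priv : ∀ {v w} → (v , w) ∈ S → PrivateAt G H S v w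
      priv {v} {w} (inj₁ (v∈D , v≢d)) with inner v∈D
      ... | u , u∈C , within = private-in-row G H S u (inj₂ (C-adj u∈C))
        (λ {v′} s∈ Nv′u → [ (λ v′∈D → dominator-unique v′∈D Nv′u (proj₁ u∈C))
          , (λ v′∉D → contradiction (trans (sym (within Nv′u)) (proj₁ (in-C s∈ v′∉D))) v≢d) ]′ (toSum (mem? D v′)))
        (λ s∈ _ → contradiction (trans (sym (proj₁ u∈C)) (proj₁ (in-C s∈ (C-∉ u∈C)))) v≢d)
      -- In a row outside E, a is the only vertex of C d in S, so that (d , w) is private to it; the
      -- column of d has been emptied.
      priv {v} {w} (inj₂ (inj₁ (refl , w∉E))) = private-in-row G H S d (inj₂ (adj-sym (C-adj a∈C)))
        (λ { (inj₁ (v′∈D , v′≢d)) Nv′d → contradiction (dominator-unique v′∈D Nv′d (r-self d∈D)) v′≢d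
           ; (inj₂ (inj₁ (v′≡a , _))) _ → v′≡a
           ; (inj₂ (inj₂ (_ , w∈E))) _ → contradiction w∈E w∉E })
        (λ { (inj₁ (_ , d≢d)) _ → contradiction refl d≢d
           ; (inj₂ (inj₁ (d≡a , _))) _ → contradiction (sym d≡a) (proj₂ a∈C)
           ; (inj₂ (inj₂ (((_ , d≢d) , _) , _))) _ → contradiction refl d≢d })
      priv {v} {w} (inj₂ (inj₂ ((v∈C , v≢a) , w∈E))) with private-of w∈E
      -- Row p also contains (a , p), as p ∉ E; it does not dominate (v , p) because C d is
      -- independent.
      ... | p , Nwp , w≢p , p∉E , unique = private-in-column G H S p Nwp
        (λ { (inj₁ (v′∈D , v′≢d)) Nv′v → contradiction (dominator-unique v′∈D Nv′v (proj₁ v∈C)) v′≢d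
           ; (inj₂ (inj₁ (refl , _))) (inj₁ a≡v) → contradiction (sym a≡v) v≢a
           ; (inj₂ (inj₁ (refl , _))) (inj₂ a~v) → contradiction a~v (indep a∈C v∈C)
           ; (inj₂ (inj₂ (_ , p∈E))) _ → contradiction p∈E p∉E })
        (λ { (inj₁ (v∈D , _)) _ → contradiction v∈D (C-∉ v∈C)
           ; (inj₂ (inj₁ (v≡a , _))) _ → contradiction v≡a v≢a
           ; (inj₂ (inj₂ (_ , w′∈E))) Nw′p → unique w′∈E Nw′p })

      -- Of the columns carrying a copy of E only those of b and b′ are counted: |S| is at least γ -
      -- |H| + (|H| - |E|) + 2|E|.
      ls rs : List ((V → ℕ) × (W → ℕ))
      ls = (ι G D , 𝟏) ∷ (δ G a , 𝟏) ∷ (δ G b , ι H E) ∷ (δ G b′ , ι H E) ∷ []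
      rs = (δ G d , 𝟏) ∷ (δ G a , ι H E) ∷ []

      pointwise : ∀ v w → eval ls v w ≤ ⟦ mem? S (v , w) ⟧ + eval rs v w
      pointwise v w with v ≟ a | v ≟ b | v ≟ b′ | v ≟ d | mem? D v | r v ≟ d | mem? E w
      ... | yes refl | yes a≡b  | _        | _        | _       | _      | _     = contradiction a≡b a≢b
      ... | yes refl | no _     | yes a≡b′ | _        | _       | _      | _     = contradiction a≡b′ a≢b′
      ... | yes refl | no _     | no _     | yes a≡d  | _       | _      | _     = contradiction a≡d (proj₂ a∈C)
      ... | yes refl | no _     | no _     | no _     | yes a∈D | _      | _     = contradiction a∈D (C-∉ a∈C)
      ... | yes refl | no _     | no _     | no _     | no _    | no ≢d  | _     = contradiction (proj₁ a∈C) ≢d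
      ... | yes refl | no _     | no _     | no _     | no _    | yes _  | yes _ = by-evaluation
      ... | yes refl | no _     | no _     | no _     | no _    | yes _  | no _  = by-evaluation
      ... | no _     | yes refl | yes b≡b′ | _        | _       | _      | _     = contradiction b≡b′ b≢b′
      ... | no _     | yes refl | no _     | yes b≡d  | _       | _      | _     = contradiction b≡d (proj₂ b∈C)
      ... | no _     | yes refl | no _     | no _     | yes b∈D | _      | _     = contradiction b∈D (C-∉ b∈C)
      ... | no _     | yes refl | no _     | no _     | no _    | no ≢d  | _     = contradiction (proj₁ b∈C) ≢d
      ... | no _     | yes refl | no _     | no _     | no _    | yes _  | yes _ = by-evaluation
      ... | no _     | yes refl | no _     | no _     | no _    | yes _  | no _  = by-evaluation
      ... | no _     | no _     | yes refl | yes b′≡d | _       | _      | _     = contradiction b′≡d (proj₂ b′∈C)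
      ... | no _     | no _     | yes refl | no _     | yes b′∈D | _     | _     = contradiction b′∈D (C-∉ b′∈C)
      ... | no _     | no _     | yes refl | no _     | no _    | no ≢d  | _     = contradiction (proj₁ b′∈C) ≢d
      ... | no _     | no _     | yes refl | no _     | no _    | yes _  | yes _ = by-evaluation
      ... | no _     | no _     | yes refl | no _     | no _    | yes _  | no _  = by-evaluation
      ... | no _     | no _     | no _     | yes _    | yes _   | yes _  | _     = by-evaluation
      ... | no _     | no _     | no _     | yes _    | yes _   | no _   | _     = by-evaluation
      ... | no _     | no _     | no _     | yes _    | no _    | _      | _     = by-evaluation
      ... | no _     | no _     | no _     | no _     | yes _   | _      | _     = by-evaluation
      ... | no _     | no _     | no _     | no _     | no _    | _      | _     = by-evaluation

      impossible : ⊥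
      impossible = finish (count-≥ G H S ls rs pointwise)
        where
        finish : ¬ (card G D * ∑ H 𝟏 + (∑ G (δ G a) * ∑ H 𝟏 + (∑ G (δ G b) * card H E + (∑ G (δ G b′) * card H E + 0)))
                 ≤ card (G □ H) S + (∑ G (δ G d) * ∑ H 𝟏 + (∑ G (δ G a) * card H E + 0)))
        finish le rewrite ∑-δ G d | ∑-δ G a | ∑-δ G b | ∑-δ G b′ | ∑-1 H | |D|m≡γ
          | private-card G H wd S (λ v w → cov (v , w)) priv =
          ℕ.<⇒≱ 0<|E| (ℕ.+-cancelˡ-≤ (γ + order H + card H E) _ _
            (subst₂ _≤_ (lhs γ (order H) (card H E)) (rhs γ (order H) (card H E)) le))
          where
          lhs : ∀ γ m h → γ + (1 * m + (1 * h + (1 * h + 0))) ≡ γ + m + h + h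
          lhs = solve-∀
          rhs : ∀ γ m h → γ + (1 * m + (1 * h + 0)) ≡ γ + m + h + 0
          rhs = solve-∀

    -- Non-adjacent x and y make C d independent by `star`, and then a third vertex is excluded by
    -- `ThreeLeaves`.
    star⇒two-leaves : ∀ {d x y} → d ∈ D → x ∈ C d → y ∈ C d → ¬ N G x y → ∀ {v} → v ∈ C d → v ≡ x ⊎ v ≡ y
    star⇒two-leaves {d} {x} {y} d∈D x∈C y∈C ¬Nxy {v} v∈C with v ≟ x | v ≟ y
    ... | yes v≡x | _       = inj₁ v≡x
    ... | no _    | yes v≡y = inj₂ v≡y
    ... | no v≢x  | no v≢y  = ⊥-elim (ThreeLeaves.impossible d∈D (star d∈D x∈C y∈C ¬Nxy)
            v∈C x∈C y∈C v≢x v≢y (¬Nxy ∘ inj₁))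

    -- If x were its own owner, it would lie in D and hence own its neighbour x′ as well.
    crossing∈C : ∀ {x x′} → Adj x x′ → r x ≢ r x′ → x ∈ C (r x)
    crossing∈C {x} {x′} x~x′ ≢ =
      refl , λ x≡rx → ≢ (sym (unique-owner (r∈D x) (subst (λ z → N G z x′) x≡rx (inj₂ x~x′))))

-- Edges between different classes

module _ (G H : Graph) (wd : WD (G □ H)) (E : Sub (Vertex H)) (tightE : Tight H E) (w₀ : Vertex H)
         (D : Sub (Vertex G)) (tightD : Tight G D) where

  open WD wd
  open Factor G H wd E tightE w₀
  open Code D tightD
  open Graph G using (Adj; adj-sym)
  open Tight tightD renaming (owner to r; owner∈ to r∈D; owner-N to r-N; owner-self to r-self)
  open Tight tightE using () renaming (owner to s; owner∈ to s∈E; owner-N to s-N)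

  private
    V = Vertex G
    W = Vertex H
    _≟_ = eq? G

  -- Were x′ adjacent to its whole class, x′ could replace r x′ in D, and then x
  -- would have two owners.
  non-neighbour : ∀ {x x′} → Adj x x′ → r x ≢ r x′ → ∃[ y ] (y ∈ C (r x′) × ¬ N G x′ y)
  non-neighbour {x} {x′} x~x′ rx≢rx′
    with any? G (λ y → mem? (C (r x′)) y ×-dec ¬? (N? G x′ y))
  ... | yes (y , y∈C , ¬N) = y , y∈C , ¬N
  ... | no ∄y = contradiction (trans (sym (Code.unique-owner D′ tightD′ rx∈D′ (r-N x)))
                                     (Code.unique-owner D′ tightD′ x′∈D′ (inj₂ (adj-sym x~x′)))) rx≢x′
    where
    d′ = r x′
    x′∈C : x′ ∈ C d′
    x′∈C = crossing∈C (adj-sym x~x′) (rx≢rx′ ∘ sym)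
    D′ : Sub V
    D′ = (λ v → v ≡ x′ ⊎ (v ∈ D × v ≢ d′)) given λ v → (v ≟ x′) ⊎-dec (mem? D v ×-dec ¬? (v ≟ d′))
    rx∈D′ : r x ∈ D′
    rx∈D′ = inj₂ (r∈D x , rx≢rx′)
    x′∈D′ : x′ ∈ D′
    x′∈D′ = inj₁ refl
    rx≢x′ : r x ≢ x′
    rx≢x′ e = C-∉ x′∈C (subst (_∈ D) e (r∈D x))
    N-x′ : ∀ {v} → r v ≡ d′ → N G x′ v
    N-x′ {v} rv≡d′ with v ≟ d′
    ... | yes refl = inj₂ (adj-sym (C-adj x′∈C))
    ... | no v≢d′  = decidable-stable (N? G x′ v) λ ¬N → ∄y (v , (rv≡d′ , v≢d′) , ¬N)
    choice : ∀ v → ∃[ u ] (u ∈ D′ × N G u v × (v ∈ D′ → u ≡ v))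
    choice v with r v ≟ d′
    ... | yes rv≡d′ = x′ , inj₁ refl , N-x′ rv≡d′ ,
      λ { (inj₁ v≡x′) → sym v≡x′ ; (inj₂ (v∈D , v≢d′)) → contradiction (trans (sym (r-self v∈D)) rv≡d′) v≢d′ }
    ... | no rv≢d′ = r v , inj₂ (r∈D v , rv≢d′) , r-N v ,
      λ { (inj₁ refl) → contradiction refl rv≢d′ ; (inj₂ (v∈D , _)) → r-self v∈D }
    external′ : ∀ {d} → d ∈ D′ → ∃[ p ] (¬ p ∈ D′ × Adj d p × (∀ {c} → c ∈ D′ → Adj c p → c ≡ d))
    -- The replaced vertex d′ is private to x′, since no other vertex of D dominates it.
    external′ (inj₁ refl) = d′
      , (λ { (inj₁ d′≡x′) → proj₂ x′∈C (sym d′≡x′) ; (inj₂ (_ , d′≢d′)) → d′≢d′ refl })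
      , adj-sym (C-adj x′∈C)
      , λ { (inj₁ c≡x′) _ → c≡x′
          ; (inj₂ (c∈D , c≢d′)) a → contradiction (dominator-unique c∈D (inj₂ a) (r-self (r∈D x′))) c≢d′ }
    -- Other members keep their inner vertex: adjacency of x′ to it would put x′ into the class of
    -- d.
    external′ (inj₂ (d∈D , d≢d′)) with inner d∈D
    ... | u , u∈C , within = u
      , (λ { (inj₁ refl) → d≢d′ (sym (proj₁ u∈C)) ; (inj₂ (u∈D , _)) → C-∉ u∈C u∈D })
      , C-adj u∈C
      , λ { (inj₁ refl) a → contradiction (sym (within (inj₂ a))) d≢d′
          ; (inj₂ (c∈D , _)) a → dominator-unique c∈D (inj₂ a) (proj₁ u∈C) }
    tightD′ : Tight G D′
    tightD′ = record
      { owner      = λ v → proj₁ (choice v)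
      ; owner∈     = λ v → proj₁ (proj₂ (choice v))
      ; owner-N    = λ v → proj₁ (proj₂ (proj₂ (choice v)))
      ; owner-self = λ {d} → proj₂ (proj₂ (proj₂ (choice d)))
      ; external   = external′
      }

  -- The class of x is a path x – r x – y whose end y has no neighbours outside it.
  record Pendant (x : V) : Set where
    field
      x∈C  : x ∈ C (r x)
      y    : V
      y∈C  : y ∈ C (r x)
      ¬Nxy : ¬ N G x y
      only : ∀ {v} → v ∈ C (r x) → v ≡ x ⊎ v ≡ y
      leaf : ∀ {v} → N G v y → r v ≡ r x

  pendant : ∀ {x x′} → Adj x x′ → r x ≢ r x′ → Pendant x
  pendant {x} {x′} x~x′ rx≢rx′ with non-neighbour (adj-sym x~x′) (rx≢rx′ ∘ sym)
  ... | y , y∈C , ¬Nxy = record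
    { x∈C = x∈C ; y = y ; y∈C = y∈C ; ¬Nxy = ¬Nxy ; only = only ; leaf = leaf (inner (r∈D x)) }
    where
    x∈C = crossing∈C x~x′ rx≢rx′
    only : ∀ {v} → v ∈ C (r x) → v ≡ x ⊎ v ≡ y
    only = star⇒two-leaves (r∈D x) x∈C y∈C ¬Nxy
    leaf : ∃[ u ] (u ∈ C (r x) × (∀ {v} → N G v u → r v ≡ r x)) → ∀ {v} → N G v y → r v ≡ r x
    -- The inner vertex of the class is x or y, and x has the neighbour x′ in another class.
    leaf (u , u∈C , within) with only u∈C
    ... | inj₁ refl = contradiction (sym (within (inj₂ (adj-sym x~x′)))) rx≢rx′
    ... | inj₂ refl = within

  -- ((D ∖ {d, d′}) × H) ∪ ({y, x′} × H) ∪ ({y′} × E) is a minimal dominating set of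
  -- size γ + |E|.
  module _ {x x′} (x~x′ : Adj x x′) (rx≢rx′ : r x ≢ r x′)
           (pendant-x : Pendant x) (pendant-x′ : Pendant x′) where

    private
      d  = r x
      d′ = r x′
      open Pendant pendant-x
      open Pendant pendant-x′ using ()
        renaming (x∈C to x′∈C; y to y′; y∈C to y′∈C; ¬Nxy to ¬Nx′y′; only to only′; leaf to leaf′)

      S : Sub (V × W)
      S = (λ (v , w) → (v ∈ D × v ≢ d × v ≢ d′) ⊎ v ≡ y ⊎ v ≡ x′ ⊎ (v ≡ y′ × w ∈ E))
          given λ (v , w) → (mem? D v ×-dec ¬? (v ≟ d) ×-dec ¬? (v ≟ d′)) ⊎-dec (v ≟ y) ⊎-dec (v ≟ x′)
            ⊎-dec ((v ≟ y′) ×-dec mem? E w)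

      y≢x′ : y ≢ x′
      y≢x′ y≡x′ = rx≢rx′ (trans (sym (proj₁ y∈C)) (cong r y≡x′))

      y≢y′ : y ≢ y′
      y≢y′ y≡y′ = rx≢rx′ (trans (sym (proj₁ y∈C)) (trans (cong r y≡y′) (proj₁ y′∈C)))

      in-y : ∀ {w} → (y , w) ∈ S
      in-y = inj₂ (inj₁ refl)
      in-x′ : ∀ {w} → (x′ , w) ∈ S
      in-x′ = inj₂ (inj₂ (inj₁ refl))

      -- Row by row, y dominates y and d, while x′ dominates x, x′ and d′. Only the column of y′
      -- remains, and a copy of E dominates it from within.
      cov : ∀ v w → ∃[ u ] (u ∈ S × N (G □ H) u (v , w))
      cov v w with r v ≟ d | r v ≟ d′ | v ≟ d | v ≟ d′
      ... | no ≢d | no ≢d′ | _ | _ = (r v , w) , inj₁ (r∈D v , ≢d , ≢d′) , N-row G H (r-N v)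
      ... | yes _ | _ | yes refl | _ = (y , w) , in-y , N-row G H (inj₂ (adj-sym (C-adj y∈C)))
      ... | yes ≡d | _ | no v≢d | _ with only (≡d , v≢d)
      ...   | inj₁ refl = (x′ , w) , in-x′ , N-row G H (inj₂ (adj-sym x~x′))
      ...   | inj₂ refl = (y , w) , in-y , inj₁ refl
      cov v w | no _ | yes _ | _ | yes refl = (x′ , w) , in-x′ , N-row G H (inj₂ (adj-sym (C-adj x′∈C)))
      cov v w | no _ | yes ≡d′ | _ | no v≢d′ with only′ (≡d′ , v≢d′)
      ...   | inj₁ refl = (x′ , w) , in-x′ , inj₁ refl
      ...   | inj₂ refl = (y′ , s w) , inj₂ (inj₂ (inj₂ (refl , s∈E w))) , N-column G H (s-N w)

      priv : ∀ {v w} → (v , w) ∈ S → PrivateAt G H S v w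
      priv {v} {w} (inj₁ (v∈D , v≢d , v≢d′)) with inner v∈D
      ... | u , u∈C , within = private-in-row G H S u (inj₂ (C-adj u∈C))
        (λ { (inj₁ (v′∈D , _)) Nv′u → dominator-unique v′∈D Nv′u (proj₁ u∈C)
           ; (inj₂ (inj₁ refl)) Nyu → contradiction (trans (sym (within Nyu)) (proj₁ y∈C)) v≢d
           ; (inj₂ (inj₂ (inj₁ refl))) Nx′u → contradiction (sym (within Nx′u)) v≢d′
           ; (inj₂ (inj₂ (inj₂ (refl , _)))) Ny′u → contradiction (trans (sym (within Ny′u)) (proj₁ y′∈C)) v≢d′ })
        (λ { (inj₁ (u∈D , _)) _ → contradiction u∈D (C-∉ u∈C)
           ; (inj₂ (inj₁ refl)) _ → contradiction (trans (sym (proj₁ u∈C)) (proj₁ y∈C)) v≢d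
           ; (inj₂ (inj₂ (inj₁ refl))) _ → contradiction (sym (proj₁ u∈C)) v≢d′
           ; (inj₂ (inj₂ (inj₂ (refl , _)))) _ → contradiction (trans (sym (proj₁ u∈C)) (proj₁ y′∈C)) v≢d′ })
      -- With d removed, y is the only dominator of d left in its row: x′ and y′ have other owners
      -- and so are not adjacent to d.
      priv {v} {w} (inj₂ (inj₁ refl)) = private-in-row G H S d (inj₂ (adj-sym (C-adj y∈C)))
        (λ { (inj₁ (v′∈D , v′≢d , _)) N′ → contradiction (dominator-unique v′∈D N′ (r-self (r∈D x))) v′≢d
           ; (inj₂ (inj₁ v′≡y)) _ → v′≡y
           ; (inj₂ (inj₂ (inj₁ refl))) N′ → contradiction (sym (unique-owner (r∈D x) (N-sym G N′))) rx≢rx′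
           ; (inj₂ (inj₂ (inj₂ (refl , _)))) N′ →
               contradiction (dominator-unique (r∈D x) (N-sym G N′) (proj₁ y′∈C)) rx≢rx′ })
        (λ { (inj₁ (_ , d≢d , _)) _ → contradiction refl d≢d
           ; (inj₂ (inj₁ d≡y)) _ → contradiction (sym d≡y) (proj₂ y∈C)
           ; (inj₂ (inj₂ (inj₁ d≡x′))) _ → contradiction (subst (_∈ D) d≡x′ (r∈D x)) (C-∉ x′∈C)
           ; (inj₂ (inj₂ (inj₂ (d≡y′ , _)))) _ → contradiction (subst (_∈ D) d≡y′ (r∈D x)) (C-∉ y′∈C) })
      -- The crossing edge makes x private to x′: y is not adjacent to x, and y′ has no neighbour
      -- outside its class.
      priv {v} {w} (inj₂ (inj₂ (inj₁ refl))) = private-in-row G H S x (inj₂ (adj-sym x~x′))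
        (λ { (inj₁ (v′∈D , v′≢d , _)) N′ → contradiction (sym (unique-owner v′∈D N′)) v′≢d
           ; (inj₂ (inj₁ refl)) N′ → contradiction (N-sym G N′) ¬Nxy
           ; (inj₂ (inj₂ (inj₁ v′≡x′))) _ → v′≡x′
           ; (inj₂ (inj₂ (inj₂ (refl , _)))) N′ → contradiction (leaf′ (N-sym G N′)) rx≢rx′ })
        (λ { (inj₁ (x∈D , _)) _ → contradiction x∈D (C-∉ x∈C)
           ; (inj₂ (inj₁ x≡y)) _ → contradiction (inj₁ x≡y) ¬Nxy
           ; (inj₂ (inj₂ (inj₁ refl))) _ → contradiction refl rx≢rx′
           ; (inj₂ (inj₂ (inj₂ (x≡y′ , _)))) _ → contradiction (trans (cong r x≡y′) (proj₁ y′∈C)) rx≢rx′ })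
      -- No vertex of S in a neighbouring column reaches y′, so the private neighbours of E in H
      -- serve within this column.
      priv {v} {w} (inj₂ (inj₂ (inj₂ (refl , w∈E)))) with private-of w∈E
      ... | p , Nwp , w≢p , p∉E , unique = private-in-column G H S p Nwp
        (λ { (inj₁ (v′∈D , _ , v′≢d′)) N′ → contradiction (dominator-unique v′∈D N′ (proj₁ y′∈C)) v′≢d′
           ; (inj₂ (inj₁ refl)) N′ → contradiction (trans (sym (proj₁ y∈C)) (leaf′ N′)) rx≢rx′
           ; (inj₂ (inj₂ (inj₁ refl))) N′ → contradiction N′ ¬Nx′y′
           ; (inj₂ (inj₂ (inj₂ (_ , p∈E)))) _ → contradiction p∈E p∉E })
        (λ { (inj₁ (y′∈D , _)) _ → contradiction y′∈D (C-∉ y′∈C)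
           ; (inj₂ (inj₁ refl)) _ → contradiction (trans (sym (proj₁ y∈C)) (proj₁ y′∈C)) rx≢rx′
           ; (inj₂ (inj₂ (inj₁ y′≡x′))) _ → contradiction (inj₁ (sym y′≡x′)) ¬Nx′y′
           ; (inj₂ (inj₂ (inj₂ (_ , w′∈E)))) Nw′p → unique w′∈E Nw′p })

      ls rs : List ((V → ℕ) × (W → ℕ))
      ls = (ι G D , 𝟏) ∷ (δ G y , 𝟏) ∷ (δ G x′ , 𝟏) ∷ (δ G y′ , ι H E) ∷ []
      rs = (δ G d , 𝟏) ∷ (δ G d′ , 𝟏) ∷ []

      pointwise : ∀ v w → eval ls v w ≤ ⟦ mem? S (v , w) ⟧ + eval rs v w
      pointwise v w with v ≟ y | v ≟ x′ | v ≟ y′ | mem? D v | v ≟ d | v ≟ d′ | mem? E w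
      ... | yes refl | yes y≡x′ | _        | _        | _       | _      | _     = contradiction y≡x′ y≢x′
      ... | yes refl | no _     | yes y≡y′ | _        | _       | _      | _     = contradiction y≡y′ y≢y′
      ... | yes refl | no _     | no _     | yes y∈D  | _       | _      | _     = contradiction y∈D (C-∉ y∈C)
      ... | yes refl | no _     | no _     | no _     | _       | _      | _     = by-evaluation
      ... | no _     | yes refl | yes x′≡y′ | _       | _       | _      | _     = contradiction (inj₁ x′≡y′) ¬Nx′y′
      ... | no _     | yes refl | no _     | yes x′∈D | _       | _      | _     = contradiction x′∈D (C-∉ x′∈C)
      ... | no _     | yes refl | no _     | no _     | _       | _      | _     = by-evaluation
      ... | no _     | no _     | yes refl | yes y′∈D | _       | _      | _     = contradiction y′∈D (C-∉ y′∈C)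
      ... | no _     | no _     | yes refl | no _     | _       | _      | yes _ = by-evaluation
      ... | no _     | no _     | yes refl | no _     | _       | _      | no _  = by-evaluation
      ... | no _     | no _     | no _     | no _     | _       | _      | _     = by-evaluation
      ... | no _     | no _     | no _     | yes _    | yes _   | _      | _     = by-evaluation
      ... | no _     | no _     | no _     | yes _    | no _    | yes _  | _     = by-evaluation
      ... | no _     | no _     | no _     | yes _    | no _    | no _   | _     = by-evaluation

    pendants-not-linked : ⊥
    pendants-not-linked = finish (count-≥ G H S ls rs pointwise)
      where
      finish : ¬ (card G D * ∑ H 𝟏 + (∑ G (δ G y) * ∑ H 𝟏 + (∑ G (δ G x′) * ∑ H 𝟏 + (∑ G (δ G y′) * card H E + 0)))
               ≤ card (G □ H) S + (∑ G (δ G d) * ∑ H 𝟏 + (∑ G (δ G d′) * ∑ H 𝟏 + 0)))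
      finish le rewrite ∑-δ G y | ∑-δ G x′ | ∑-δ G y′ | ∑-δ G d | ∑-δ G d′ | ∑-1 H | |D|m≡γ
        | private-card G H wd S cov priv =
        ℕ.<⇒≱ 0<|E| (ℕ.+-cancelˡ-≤ (γ + order H + order H) _ _
          (subst₂ _≤_ (lhs γ (order H) (card H E)) (rhs γ (order H)) le))
        where
        lhs : ∀ γ m h → γ + (1 * m + (1 * m + (1 * h + 0))) ≡ γ + m + m + h
        lhs = solve-∀
        rhs : ∀ γ m → γ + (1 * m + (1 * m + 0)) ≡ γ + m + m + 0
        rhs = solve-∀

  adj⇒same-owner : ∀ {x x′} → Adj x x′ → r x ≡ r x′
  adj⇒same-owner {x} {x′} x~x′ = decidable-stable (r x ≟ r x′) λ rx≢rx′ →
    pendants-not-linked x~x′ rx≢rx′ (pendant x~x′ rx≢rx′) (pendant (adj-sym x~x′) (rx≢rx′ ∘ sym))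

-- Identifying the product

open Graph using (Adj)

≅-trans : ∀ X Y Z → X ≅ Y → Y ≅ Z → X ≅ Z
≅-trans X Y Z X≅Y Y≅Z = record
  { vertex-bij = _≅_.vertex-bij Y≅Z ↔-∘ _≅_.vertex-bij X≅Y
  ; adj-iff    = λ u v → _≅_.adj-iff Y≅Z _ _ ⇔-∘ _≅_.adj-iff X≅Y u v
  }

□-cong : ∀ X X′ Y Y′ → X ≅ X′ → Y ≅ Y′ → (X □ Y) ≅ (X′ □ Y′)
□-cong X X′ Y Y′ X≅X′ Y≅Y′ = record
  { vertex-bij = F.vertex-bij ×-↔ G.vertex-bij
  ; adj-iff    = λ (x₁ , y₁) (x₂ , y₂) → mk⇔
      (λ { (inj₁ (refl , a)) → inj₁ (refl , Equivalence.to (G.adj-iff y₁ y₂) a)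
         ; (inj₂ (a , refl)) → inj₂ (Equivalence.to (F.adj-iff x₁ x₂) a , refl) })
      (λ { (inj₁ (e , a)) → inj₁ (injective F.vertex-bij e , Equivalence.from (G.adj-iff y₁ y₂) a)
         ; (inj₂ (a , e)) → inj₂ (Equivalence.from (F.adj-iff x₁ x₂) a , injective G.vertex-bij e) })
  }
  where
  module F = _≅_ X≅X′
  module G = _≅_ Y≅Y′
  injective : ∀ {A B : Set} (f : A ↔ B) {x y} → Inverse.to f x ≡ Inverse.to f y → x ≡ y
  injective f e = trans (sym (Inverse.inverseʳ f refl)) (Inverse.inverseʳ f e)

Complete : Graph → Set
Complete X = ∀ u v → u ≢ v → Adj X u v

record IsP₃ (X : Graph) : Set where
  field
    {c x y}   : Vertex X
    c~x       : Adj X c x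
    c~y       : Adj X c y
    ¬Nxy      : ¬ N X x y
    exhaust   : ∀ v → v ≡ c ⊎ v ≡ x ⊎ v ≡ y

  x≢c : x ≢ c
  x≢c e = Graph.adj-irrefl X (sym e) c~x

  y≢c : y ≢ c
  y≢c e = Graph.adj-irrefl X (sym e) c~y

complete⇒K : ∀ {X} → Complete X → X ≅ K (order X)
complete⇒K {X} complete = record
  { vertex-bij = enum X
  ; adj-iff    = λ u v → mk⇔
      (λ a e → Graph.adj-irrefl X (index-injective X e) a)
      (λ i≢j → complete u v (i≢j ∘ cong (index X)))
  }

module _ {X : Graph} (isP₃ : IsP₃ X) where

  open IsP₃ isP₃
  open Graph X using (adj-sym; adj-irrefl)

  private
    place : Fin 3 → Vertex X
    place 0F = x
    place 1F = c
    place 2F = y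

    position : ∀ v → ∃[ i ] place i ≡ v
    position v with exhaust v
    ... | inj₁ refl        = 1F , refl
    ... | inj₂ (inj₁ refl) = 0F , refl
    ... | inj₂ (inj₂ refl) = 2F , refl

    place-injective : ∀ i j → place i ≡ place j → i ≡ j
    place-injective 0F 0F _ = refl
    place-injective 0F 1F e = contradiction e x≢c
    place-injective 0F 2F e = contradiction (inj₁ e) ¬Nxy
    place-injective 1F 0F e = contradiction (sym e) x≢c
    place-injective 1F 1F _ = refl
    place-injective 1F 2F e = contradiction (sym e) y≢c
    place-injective 2F 0F e = contradiction (inj₁ (sym e)) ¬Nxy
    place-injective 2F 1F e = contradiction e y≢c
    place-injective 2F 2F _ = refl

    place-adj : ∀ i j → Adj X (place i) (place j) ⇔ Adj (P 3) i j
    place-adj 0F 0F = mk⇔ (λ a → contradiction a (adj-irrefl refl)) λ { (inj₁ ()) ; (inj₂ ()) }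
    place-adj 0F 1F = mk⇔ (λ _ → inj₁ refl) (λ _ → adj-sym c~x)
    place-adj 0F 2F = mk⇔ (λ a → contradiction (inj₂ a) ¬Nxy) λ { (inj₁ ()) ; (inj₂ ()) }
    place-adj 1F 0F = mk⇔ (λ _ → inj₂ refl) (λ _ → c~x)
    place-adj 1F 1F = mk⇔ (λ a → contradiction a (adj-irrefl refl)) λ { (inj₁ ()) ; (inj₂ ()) }
    place-adj 1F 2F = mk⇔ (λ _ → inj₁ refl) (λ _ → c~y)
    place-adj 2F 0F = mk⇔ (λ a → contradiction (inj₂ (adj-sym a)) ¬Nxy) λ { (inj₁ ()) ; (inj₂ ()) }
    place-adj 2F 1F = mk⇔ (λ _ → inj₂ refl) (λ _ → adj-sym c~y)
    place-adj 2F 2F = mk⇔ (λ a → contradiction a (adj-irrefl refl)) λ { (inj₁ ()) ; (inj₂ ()) }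

  IsP₃⇒P₃ : X ≅ P 3
  IsP₃⇒P₃ = record
    { vertex-bij = mk↔ₛ′ (proj₁ ∘ position) place
        (λ i → place-injective _ i (proj₂ (position (place i)))) (proj₂ ∘ position)
    ; adj-iff = λ u v → subst₂ (λ u′ v′ → Adj X u′ v′ ⇔ Adj (P 3) (proj₁ (position u)) (proj₁ (position v)))
        (proj₂ (position u)) (proj₂ (position v)) (place-adj (proj₁ (position u)) (proj₁ (position v)))
    }

≅⇒order≡ : ∀ {X Y} → X ≅ Y → order X ≡ order Y
≅⇒order≡ {X} {Y} X≅Y = ↔⇒≡ (enum Y ↔-∘ (_≅_.vertex-bij X≅Y ↔-∘ ↔-sym (enum X)))

-- Connected factors and their shape

connected-factor : ∀ X Y → Vertex Y → Connected (X □ Y) → Connected X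
connected-factor X Y y connected u v = project (connected (u , y) (v , y))
  where
  project : ∀ {p q} → Star (Adj (X □ Y)) p q → Star (Adj X) (proj₁ p) (proj₁ q)
  project ε = ε
  project (inj₁ (refl , _) ◅ path) = project path
  project (inj₂ (a , _) ◅ path)    = a ◅ project path

connected-comm : ∀ X Y → Connected (X □ Y) → Connected (Y □ X)
connected-comm X Y connected (y , x) (y′ , x′) = go (connected (x , y) (x′ , y′))
  where
  go : ∀ {x y x′ y′} → Star (Adj (X □ Y)) (x , y) (x′ , y′) → Star (Adj (Y □ X)) (y , x) (y′ , x′)
  go ε = ε
  go (inj₁ (e , a) ◅ path) = inj₂ (a , e) ◅ go path
  go (inj₂ (a , e) ◅ path) = inj₁ (e , a) ◅ go path

some-vertex : ∀ X → 2 ≤ order X → Vertex X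
some-vertex X 2≤n = vertexAt X (fromℕ< {0} (ℕ.<-trans (ℕ.n<1+n 0) 2≤n))

connected⇒noIsolated : ∀ X → 2 ≤ order X → Connected X → NoIsolated X
connected⇒noIsolated X 2≤n connected v = other (any? X λ u → ¬? (eq? X u v))
  where
  first-step : ∀ {u} → u ≢ v → Star (Adj X) v u → ∃[ w ] Adj X v w
  first-step u≢v ε       = contradiction refl u≢v
  first-step u≢v (a ◅ _) = _ , a
  other : Dec (∃[ u ] u ≢ v) → ∃[ w ] Adj X v w
  other (yes (u , u≢v)) = first-step u≢v (connected v u)
  other (no ∄u) = contradiction 2≤n (ℕ.<⇒≱ (s≤s (begin
    order X         ≡⟨ sym (∑-1 X) ⟩
    ∑ X (λ _ → 1)   ≤⟨ ∑-mono X (λ u → ℕ.≤-reflexive (sym (⟦⟧-true (eq? X u v)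
                         (decidable-stable (eq? X u v) λ u≢v → ∄u (u , u≢v))))) ⟩
    ∑ X (δ X v)     ≡⟨ ∑-δ X v ⟩
    1               ∎)))
    where open ℕ.≤-Reasoning

-- What remains of the code once there is a single class, stated without D so that both factors can
-- be identified in the same way.
record Summary (X : Graph) : Set where
  field
    centre    : Vertex X
    universal : ∀ v → N X centre v
    two-leaves : ∀ {x y} → x ≢ centre → y ≢ centre → ¬ N X x y → ∀ {v} → v ≢ centre → v ≡ x ⊎ v ≡ y

module _ (G H : Graph) (wd : WD (G □ H)) (E : Sub (Vertex H)) (tightE : Tight H E) (w₀ : Vertex H)
         (D : Sub (Vertex G)) (tightD : Tight G D) (v₀ : Vertex G) (connected : Connected G) where

  open Factor G H wd E tightE w₀
  open Code D tightD
  open Tight tightD renaming (owner to r)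

  one-owner : ∀ v → r v ≡ r v₀
  one-owner v = constant (connected v v₀)
    where
    constant : ∀ {u v} → Star (Adj G) u v → r u ≡ r v
    constant ε          = refl
    constant (a ◅ path) = trans (adj⇒same-owner G H wd E tightE w₀ D tightD a) (constant path)

  order≡fibre : order G ≡ card G (fibre G r (r v₀))
  order≡fibre = trans (sym (∑-1 G))
    (∑-cong G λ v → sym (⟦⟧-true (mem? (fibre G r (r v₀)) v) (one-owner v)))

  order≡k : order G ≡ k
  order≡k = trans order≡fibre (fibre-size tightD r owner∈ owner-N (owner∈ v₀))

  summary : Summary G
  summary = record
    { centre     = r v₀
    ; universal  = λ v → subst (λ d → N G d v) (one-owner v) (owner-N v)
    ; two-leaves = λ {x} {y} x≢ y≢ ¬Nxy {v} v≢ →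
        star⇒two-leaves (owner∈ v₀) (one-owner x , x≢) (one-owner y , y≢) ¬Nxy (one-owner v , v≢)
    }

-- The centre is adjacent to everything else, so two distinct non-adjacent vertices are both leaves;
-- by `two-leaves` they are then all the leaves.
shape : ∀ {X} → Summary X → Complete X ⊎ IsP₃ X
shape {X} sum with any? X (λ x → any? X λ y → ¬? (N? X x y))
... | no ∄xy = inj₁ λ u v u≢v → [ (λ u≡v → contradiction u≡v u≢v) , id ]′
        (decidable-stable (N? X u v) λ ¬Nuv → ∄xy (u , v , ¬Nuv))
... | yes (x , y , ¬Nxy) = inj₂ record
  { c~x = adj x≢c ; c~y = adj y≢c ; ¬Nxy = ¬Nxy ; exhaust = exhaust }
  where
  open Summary sum
  x≢c : x ≢ centre
  x≢c refl = ¬Nxy (universal y)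
  y≢c : y ≢ centre
  y≢c refl = ¬Nxy (N-sym X (universal x))
  adj : ∀ {v} → v ≢ centre → Adj X centre v
  adj {v} v≢c = [ (λ c≡v → contradiction (sym c≡v) v≢c) , id ]′ (universal v)
  exhaust : ∀ v → v ≡ centre ⊎ v ≡ x ⊎ v ≡ y
  exhaust v with eq? X v centre
  ... | yes v≡c = inj₁ v≡c
  ... | no v≢c  = inj₂ (two-leaves x≢c y≢c ¬Nxy v≢c)

-- {c} × H is a dominating set of size 3, while the corners and the centre of the
-- 3 × 3 grid form a minimal dominating set of size 5.
module _ {G H : Graph} (wd : WD (G □ H)) (isP-G : IsP₃ G) (isP-H : IsP₃ H) where

  open WD wd
  open IsP₃ isP-G
  open IsP₃ isP-H using () renaming (c to c′)

  private

    P₃-leaves : ∀ {X} (isP : IsP₃ X) {u v} → u ≢ IsP₃.c isP → v ≢ IsP₃.c isP → N X u v → u ≡ v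
    P₃-leaves {X} isP {u} {v} u≢c v≢c Nuv with IsP₃.exhaust isP u | IsP₃.exhaust isP v
    ... | inj₁ u≡c | _ = contradiction u≡c u≢c
    ... | _ | inj₁ v≡c = contradiction v≡c v≢c
    ... | inj₂ (inj₁ refl) | inj₂ (inj₁ refl) = refl
    ... | inj₂ (inj₁ refl) | inj₂ (inj₂ refl) = contradiction Nuv (IsP₃.¬Nxy isP)
    ... | inj₂ (inj₂ refl) | inj₂ (inj₁ refl) = contradiction (N-sym X Nuv) (IsP₃.¬Nxy isP)
    ... | inj₂ (inj₂ refl) | inj₂ (inj₂ refl) = refl

    centre-N : ∀ {X} (isP : IsP₃ X) v → N X (IsP₃.c isP) v
    centre-N isP v with IsP₃.exhaust isP v
    ... | inj₁ refl        = inj₁ refl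
    ... | inj₂ (inj₁ refl) = inj₂ (IsP₃.c~x isP)
    ... | inj₂ (inj₂ refl) = inj₂ (IsP₃.c~y isP)

    V = Vertex G
    W = Vertex H

    column : Sub V
    column = (_≡ c) given λ v → eq? G v c

    γ≤order : γ ≤ order H
    γ≤order = subst (γ ≤_)
      (trans (card-cylinder G H column) (trans (cong (_* order H) (∑-δ G c)) (ℕ.*-identityˡ _)))
      (bound (cylinder G H column) λ (v , w) → (c , w) , refl , N-row G H (centre-N isP-G v))

    order≡3 : order H ≡ 3
    order≡3 = ≅⇒order≡ (IsP₃⇒P₃ isP-H)

    S : Sub (V × W)
    S = (λ (v , w) → (v ≢ c × w ≢ c′) ⊎ (v ≡ c × w ≡ c′))
        given λ (v , w) → (¬? (eq? G v c) ×-dec ¬? (eq? H w c′)) ⊎-dec (eq? G v c ×-dec eq? H w c′)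

    cov : ∀ v w → ∃[ u ] (u ∈ S × N (G □ H) u (v , w))
    cov v w with eq? G v c | eq? H w c′
    ... | no v≢c   | no w≢c′  = (v , w) , inj₁ (v≢c , w≢c′) , inj₁ refl
    ... | no v≢c   | yes refl = (c , w) , inj₂ (refl , refl) , N-row G H (centre-N isP-G v)
    ... | yes refl | no w≢c′  = (v , c′) , inj₂ (refl , refl) , N-column G H (centre-N isP-H w)
    ... | yes refl | yes refl = (v , w) , inj₂ (refl , refl) , inj₁ refl

    priv : ∀ {v w} → (v , w) ∈ S → PrivateAt G H S v w
    priv {v} (inj₁ (v≢c , w≢c′)) = private-in-row G H S v (inj₁ refl)
      (λ { (inj₁ (v′≢c , _)) Nv′v → P₃-leaves isP-G v′≢c v≢c Nv′v
         ; (inj₂ (_ , w≡c′)) _ → contradiction w≡c′ w≢c′ })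
      (λ { (inj₁ (_ , w′≢c′)) Nw′w → refl , P₃-leaves isP-H w′≢c′ w≢c′ Nw′w
         ; (inj₂ (v≡c , _)) _ → contradiction v≡c v≢c })
    priv (inj₂ (refl , refl)) = private-in-row G H S c (inj₁ refl)
      (λ { (inj₁ (_ , c′≢c′)) _ → contradiction refl c′≢c′ ; (inj₂ (v′≡c , _)) _ → v′≡c })
      (λ { (inj₁ (c≢c , _)) _ → contradiction refl c≢c ; (inj₂ (_ , w′≡c′)) _ → refl , w′≡c′ })

    -- Counting the four corners is enough: |S| ≥ 6 - 2 already exceeds the bound γ ≤ 3.
    ls rs : List ((V → ℕ) × (W → ℕ))
    ls = (δ G x , 𝟏) ∷ (δ G y , 𝟏) ∷ []
    rs = (δ G x , δ H c′) ∷ (δ G y , δ H c′) ∷ []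

    pointwise : ∀ v w → eval ls v w ≤ ⟦ mem? S (v , w) ⟧ + eval rs v w
    pointwise v w with eq? G v x | eq? G v y | eq? G v c | eq? H w c′
    ... | yes refl | yes x≡y | _       | _     = contradiction (inj₁ x≡y) ¬Nxy
    ... | yes refl | no _    | yes x≡c | _     = contradiction x≡c x≢c
    ... | yes refl | no _    | no _    | yes _ = by-evaluation
    ... | yes refl | no _    | no _    | no _  = by-evaluation
    ... | no _     | yes refl | yes y≡c | _    = contradiction y≡c y≢c
    ... | no _     | yes refl | no _   | yes _ = by-evaluation
    ... | no _     | yes refl | no _   | no _  = by-evaluation
    ... | no _     | no _    | _       | _     = by-evaluation

  not-both-P₃ : ⊥
  not-both-P₃ = finish (count-≥ G H S ls rs pointwise)
    where
    finish : ¬ ∑ G (δ G x) * ∑ H 𝟏 + (∑ G (δ G y) * ∑ H 𝟏 + 0)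
               ≤ card (G □ H) S + (∑ G (δ G x) * ∑ H (δ H c′) + (∑ G (δ G y) * ∑ H (δ H c′) + 0))
    finish le rewrite ∑-δ G x | ∑-δ G y | ∑-δ H c′ | ∑-1 H | order≡3 | private-card G H wd S cov priv =
      contradiction (ℕ.≤-trans le (ℕ.+-monoˡ-≤ 2 (subst (γ ≤_) order≡3 γ≤order)))
        λ { (s≤s (s≤s (s≤s (s≤s (s≤s ()))))) }

forward : (G H : Graph) → 2 ≤ order G → 2 ≤ order H → Connected (G □ H) → WellDominated (G □ H) →
  ((G □ H) ≅ (P 3 □ K 3) ⊎ (∃[ n ] (2 ≤ n × (G □ H) ≅ (K n □ K n))))
forward G H 2≤G 2≤H connected wellDominated = conclude
  (shape (summary G H wd E tightE w₀ D tightD v₀ connectedG))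
  (shape (summary H G wd′ D tightD v₀ E tightE w₀ connectedH))
  where
  wd = wellDominated⇒WD (G □ H) wellDominated
  wd′ = WD-≅ (□-comm G H) wd
  v₀ = some-vertex G 2≤G
  w₀ = some-vertex H 2≤H
  connectedG = connected-factor G H w₀ connected
  connectedH = connected-factor H G v₀ (connected-comm G H connected)
  code-G = bollobás-cockayne G (connected⇒noIsolated G 2≤G connectedG)
  code-H = bollobás-cockayne H (connected⇒noIsolated H 2≤H connectedH)
  D = proj₁ code-G
  tightD = proj₂ code-G
  E = proj₁ code-H
  tightE = proj₂ code-H
  -- The number `k` attached to G is the size of the class of w₀ in H, and that class is all of H.
  same-order : order G ≡ order H
  same-order = trans (order≡k G H wd E tightE w₀ D tightD v₀ connectedG)
                     (sym (order≡fibre H G wd′ D tightD v₀ E tightE w₀ connectedH))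
  complete⇒K′ : ∀ {X n} → order X ≡ n → Complete X → X ≅ K n
  complete⇒K′ refl = complete⇒K
  conclude : Complete G ⊎ IsP₃ G → Complete H ⊎ IsP₃ H → _
  conclude (inj₁ cG) (inj₁ cH) = inj₂ (order G , 2≤G ,
    □-cong G (K (order G)) H (K (order G)) (complete⇒K cG) (complete⇒K′ (sym same-order) cH))
  conclude (inj₁ cG) (inj₂ pH) = inj₁ (≅-trans (G □ H) (H □ G) (P 3 □ K 3) (□-comm G H)
    (□-cong H (P 3) G (K 3) (IsP₃⇒P₃ pH) (complete⇒K′ (trans same-order (≅⇒order≡ (IsP₃⇒P₃ pH))) cG)))
  conclude (inj₂ pG) (inj₁ cH) = inj₁
    (□-cong G (P 3) H (K 3) (IsP₃⇒P₃ pG) (complete⇒K′ (trans (sym same-order) (≅⇒order≡ (IsP₃⇒P₃ pG))) cH))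
  conclude (inj₂ pG) (inj₂ pH) = ⊥-elim (not-both-P₃ wd pG pH)

corollary1 : (G H : Graph) →
    2 ≤ Graph.order G → 2 ≤ Graph.order H →
    Connected (G □ H) →
    WellDominated (G □ H) ⇔
    ((G □ H) ≅ (P 3 □ K 3) ⊎ (∃[ n ] (2 ≤ n × (G □ H) ≅ (K n □ K n))))
corollary1 G H 2≤G 2≤H connected = mk⇔ (forward G H 2≤G 2≤H connected) λ
  { (inj₁ ≅P₃□K₃)          → WD⇒wellDominated _
      (WD-≅ (≅-sym ≅P₃□K₃) (wellDominated⇒WD _ P₃□K₃.wellDominated))
  ; (inj₂ (n , _ , ≅K□K)) → WD⇒wellDominated _ (WD-≅ (≅-sym ≅K□K) (Rook.K□K-WD n))
  }
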